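{- Let $n$ be an odd positive integer such that $D=n^2+1$ is squarefree, and suppose $h(D)=1$. Then $D$ is a quadratic residue modulo at least one of the primes $5,7,41,61,1861$.
   Context: For a squarefree integer $D>1$, $h(D)$ denotes the class number of the real quadratic field $\mathbb{Q}(\sqrt D)$. Here "$D$ is a quadratic residue modulo the prime $p$" means that $D$ is congruent to a square modulo $p$ (the residue $0$ being allowed), i.e. the Legendre symbol $\left(\frac{D}{p}\right)$ is not $-1$. -}

module Defs where

open import Data.Fin.Base using (Fin)
open import Data.Integer.Base as ℤ using (ℤ; +_)
import Data.Integer.Divisibility as ℤ
open import Data.List.Base using (List; []; _∷_; map)
open import Data.List.Relation.Unary.All using (All)
open import Data.List.Relation.Unary.Any using (Any)
open import Data.Nat.Base as ℕ using (ℕ)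
import Data.Nat.Divisibility as ℕ
open import Data.Product.Base using (∃; ∃-syntax; _×_)
open import Data.Rational.Base as ℚ using (ℚ; 0ℚ; 1ℚ)
open import Function.Definitions using (Bijective)
open import Relation.Binary.PropositionalEquality using (_≡_; _≢_)
open import Relation.Unary using (Pred; _≐_)
open import Level using (0ℓ)

Squarefree : ℕ → Set
Squarefree n = ∀ d → d ℕ.* d ℕ.∣ n → d ≡ 1

-- The residue 0 is allowed.
_IsSquareModulo_ : ℕ → ℕ → Set
D IsSquareModulo p = ∃[ x ] (+ p) ℤ.∣ (x ℤ.* x ℤ.- (+ D))

-- The field ℚ(√D) and its class number. The construction makes sense for
-- every D, but it is the intended one only when D > 1 is squarefree, as
-- otherwise (D a perfect square) K is not a field.
module QuadraticField (D : ℕ) where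

  -- a +√ b stands for a + b√D.
  record K : Set where
    constructor _+√_
    field
      rat irr : ℚ

  infix 5 _+√_

  fromℚ : ℚ → K
  fromℚ q = q +√ 0ℚ

  fromℤ : ℤ → K
  fromℤ c = fromℚ (c ℚ./ 1)

  0K 1K : K
  0K = fromℚ 0ℚ
  1K = fromℚ 1ℚ

  infixl 6 _+_
  infixl 7 _*_

  _+_ _*_ : K → K → K
  (a +√ b) + (c +√ d) = (a ℚ.+ c) +√ (b ℚ.+ d)
  (a +√ b) * (c +√ d) =
    (a ℚ.* c ℚ.+ ((+ D) ℚ./ 1) ℚ.* (b ℚ.* d)) +√ (a ℚ.* d ℚ.+ b ℚ.* c)

  -- c₀ ∷ c₁ ∷ … ∷ c_{m-1} ∷ [] is the monic polynomial
  -- c₀ + c₁ X + … + c_{m-1} X^{m-1} + X^m (leading coefficient not listed).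
  evalMonic : List ℤ → K → K
  evalMonic []       α = 1K
  evalMonic (c ∷ cs) α = fromℤ c + α * evalMonic cs α

  -- Membership in the ring of integers 𝒪 of K.
  Integral : Pred K 0ℓ
  Integral α = ∃[ cs ] evalMonic cs α ≡ 0K

  -- The 𝒪-submodule of K generated by a list.
  ⟨_⟩ : List K → Pred K 0ℓ
  ⟨ [] ⟩     x = x ≡ 0K
  ⟨ g ∷ gs ⟩ x = ∃[ r ] ∃[ y ] Integral r × ⟨ gs ⟩ y × x ≡ r * g + y

  -- Nonzero ideals of 𝒪. Since 𝒪 is Noetherian, every ideal is finitely
  -- generated; ideals are given by generators because, constructively, an
  -- arbitrary predicate closed under the ideal operations need not have any.
  record NonzeroIdeal : Set where
    field
      generators : List K
      integral   : All Integral generators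
      nonzero    : Any (_≢ 0K) generators

  open NonzeroIdeal public

  -- The underlying set of the ideal αI.
  _·_ : K → NonzeroIdeal → Pred K 0ℓ
  α · I = ⟨ map (α *_) (generators I) ⟩

  -- I and J lie in the same ideal class: αI = βJ for some nonzero α, β ∈ 𝒪.
  _∼_ : NonzeroIdeal → NonzeroIdeal → Set
  I ∼ J = ∃[ α ] ∃[ β ]
    Integral α × α ≢ 0K × Integral β × β ≢ 0K × (α · I) ≐ (β · J)

-- h(D) = h: there are exactly h ideal classes, i.e. some family of h ideals
-- represents every class exactly once.
ClassNumber[_]≡_ : ℕ → ℕ → Set
ClassNumber[ D ]≡ h = ∃[ I ] Bijective {A = Fin h} _≡_ _∼_ I
  where open QuadraticField D

{-# OPTIONS --safe #-}

-- As n is odd, D = n² + 1 ≡ 2 (mod 4), so 2 ramifies: (2) is the square of the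
-- ideal (2, √D). If h(D) = 1, this ideal has a generator, which is of norm ±2.
-- For n ≥ 2 no element of ℤ[√D] has norm ±2: as long as |norm| ≤ 2 and q ≠ 0,
-- multiplication by the unit n - √D, of norm -1, decreases the absolute value of
-- the coefficient q of p + q√D (p, q ≥ 0), so that in the end |norm| is a square.
-- Hence n = 1, and D = 2 ≡ 3² (mod 7).

module Submission where

open import Defs
open import Data.Nat.Base using (ℕ; _+_; _*_; _^_; _<_)
open import Data.Nat.Divisibility using (_∣_)
open import Data.List.Base using (List; []; _∷_)
open import Data.List.Relation.Unary.Any using (Any)
open import Relation.Nullary.Negation using (¬_)

open import Algebra.Bundles using (CommutativeSemiring)
import Algebra.Solver.Ring.NaturalCoefficients.Default as SemiringSolver
open import Algebra.Structures.Biased using (isCommutativeSemiringˡ)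
open import Data.Fin.Base using (zero)
open import Data.Integer.Base as ℤ using (ℤ; +_; ∣_∣; 0ℤ; 1ℤ)
import Data.Integer.Divisibility.Signed as ℤˢ
import Data.Integer.Properties as ℤ
import Data.Integer.Tactic.RingSolver as ℤ-Solver
open import Data.List.Base using (length; map)
open import Data.List.Relation.Unary.All using (All; []; _∷_)
open import Data.List.Relation.Unary.Any using (here; there)
open import Data.Nat.Base as ℕ using (zero; suc; z≤n; s≤s)
open import Data.Nat.Coprimality as Coprime using (Coprime)
open import Data.Nat.Divisibility as ℕ using (divides)
open import Data.Nat.Induction using (<-rec)
open import Data.Nat.Primality using (euclidsLemma; prime[2])
import Data.Nat.Properties as ℕ
import Data.Nat.Tactic.RingSolver as ℕ-Solver
open import Data.Product.Base using (∃-syntax; _×_; _,_; proj₁; proj₂)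
open import Data.Rational.Base as ℚ using (ℚ; mkℚ; 0ℚ; 1ℚ; toℚᵘ; ↥_; ↧_; ↧ₙ_)
import Data.Rational.Properties as ℚ
open import Data.Rational.Unnormalised.Base as ℚᵘ using (mkℚᵘ; *≡*)
import Data.Rational.Unnormalised.Properties as ℚᵘ
open import Data.Sum.Base using ([_,_]′; inj₁; inj₂)
open import Function.Base using (id)
open import Level using (0ℓ)
open import Relation.Binary.PropositionalEquality
open import Relation.Nullary.Decidable using (yes; no; dec⇒maybe)
open import Relation.Nullary.Negation using (contradiction)
open import Tactic.RingSolver using (solve-∀)
open import Tactic.RingSolver.Core.AlmostCommutativeRing
  using (AlmostCommutativeRing; fromCommutativeRing)

-- The norm of a generator c of (2, √D) divides 4 and -D, the norms of 2 and √D; being even, while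
-- D/2 is odd, it is ±2. Two obstacles precede this argument. `Integral` allows monic polynomials of
-- any degree, so the cofactors of c, a priori only integral, first have to be placed in ℤ[√D];
-- their traces and norms do this once these are known to be integers. And an ideal class relation
-- supplies multipliers rather than quotients, so c divides 2 and √D only after multiplication by
-- some αε. Norms move this equation to ℚ, where αε can be cancelled provided that nonzero elements
-- have nonzero norm. This comes from the same descent as the exclusion of ±2: a norm 0 is the
-- square of r = 0, and undoing the steps gives p = q = 0. Hence the clause on r in `norm-descent`.

norm : ℕ → ℤ → ℤ → ℤ
norm d p q = p ℤ.* p ℤ.- + d ℤ.* (q ℤ.* q)

-- Descent on elements of small norm in ℤ[√d], d = n² + 1.

module Descent (k : ℕ) (1≤k : 1 ℕ.≤ k) where

  n d : ℕ
  n = suc k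
  d = suc (n * n)

  -- The amount by which ((2 + k) q)² exceeds d q², and d q² exceeds (k q)².
  gap : ℕ → ℕ
  gap q = (2 * k + 2) * (q * q)

  -- Here n ≥ 2 enters: it makes the gap at least 4. For n = q = 1 the gap would be 2, and 2 + √2
  -- does have norm 2.
  gap-large : ∀ {q e} → 1 ℕ.≤ q → e ℕ.≤ 2 → ¬ (gap q ℕ.≤ e)
  gap-large {q} {e} 1≤q e≤2 gap≤e = ℕ.<⇒≱ (s≤s (s≤s (s≤s z≤n))) (begin
    4            ≤⟨ ℕ.*-mono-≤ (ℕ.+-monoˡ-≤ 2 (ℕ.*-monoʳ-≤ 2 1≤k)) (ℕ.*-mono-≤ 1≤q 1≤q) ⟩
    gap q        ≤⟨ gap≤e ⟩
    e            ≤⟨ e≤2 ⟩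
    2            ∎)
    where open ℕ.≤-Reasoning

  -- (n - 1)² and (n + 1)² are both at distance 2n from d, so p + q√d has norm -`gap q` at p = k q
  -- and `gap q` at p = (2 + k) q. A norm of absolute value at most 2 keeps p strictly between;
  -- `>-bound` is the other half.
  <-bound : ∀ {p q e} → 1 ℕ.≤ q → e ℕ.≤ 2 →
    p * p ℕ.≤ e + d * (q * q) → p < (2 + k) * q
  <-bound {p} {q} {e} 1≤q e≤2 le = ℕ.≰⇒> λ [2+k]q≤p →
    gap-large 1≤q e≤2 (ℕ.+-cancelˡ-≤ (d * (q * q)) (gap q) e (begin
      d * (q * q) + gap q            ≡⟨ square k q ⟩
      ((2 + k) * q) * ((2 + k) * q)  ≤⟨ ℕ.*-mono-≤ [2+k]q≤p [2+k]q≤p ⟩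
      p * p                          ≤⟨ le ⟩
      e + d * (q * q)                ≡⟨ ℕ.+-comm e _ ⟩
      d * (q * q) + e                ∎))
    where
    open ℕ.≤-Reasoning
    square : ∀ k q →
      (1 + suc k * suc k) * (q * q) + (2 * k + 2) * (q * q) ≡ ((2 + k) * q) * ((2 + k) * q)
    square = ℕ-Solver.solve-∀

  >-bound : ∀ {p q e} → 1 ℕ.≤ q → e ℕ.≤ 2 →
    d * (q * q) ℕ.≤ p * p + e → k * q < p
  >-bound {p} {q} {e} 1≤q e≤2 le = ℕ.≰⇒> λ p≤kq →
    gap-large 1≤q e≤2 (ℕ.+-cancelˡ-≤ ((k * q) * (k * q)) (gap q) e (begin
      (k * q) * (k * q) + gap q      ≡⟨ square k q ⟩
      d * (q * q)                    ≤⟨ le ⟩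
      p * p + e                      ≤⟨ ℕ.+-monoˡ-≤ e (ℕ.*-mono-≤ p≤kq p≤kq) ⟩
      (k * q) * (k * q) + e          ∎))
    where
    open ℕ.≤-Reasoning
    square : ∀ k q →
      (k * q) * (k * q) + (2 * k + 2) * (q * q) ≡ (1 + suc k * suc k) * (q * q)
    square = ℕ-Solver.solve-∀

  norm-abs : ∀ p q → norm d (+ ∣ p ∣) (+ ∣ q ∣) ≡ norm d p q
  norm-abs p q = cong₂ (λ x y → x ℤ.- + d ℤ.* y) (sq p) (sq q)
    where
    sq : ∀ z → + ∣ z ∣ ℤ.* + ∣ z ∣ ≡ z ℤ.* z
    sq (+ _) = refl
    sq ℤ.-[1+ _ ] = refl

  ∣dqq∣ : ∀ q → ∣ + d ℤ.* (+ q ℤ.* + q) ∣ ≡ d * (q * q)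
  ∣dqq∣ q = trans (ℤ.abs-* (+ d) (+ q ℤ.* + q)) (cong (d *_) (ℤ.abs-* (+ q) (+ q)))

  norm≤ : ∀ p q → p * p ℕ.≤ ∣ norm d (+ p) (+ q) ∣ + d * (q * q)
  norm≤ p q = begin
    p * p                              ≡⟨ ℤ.abs-* (+ p) (+ p) ⟨
    ∣ + p ℤ.* + p ∣                    ≡⟨ cong ∣_∣ (split (+ p) (+ q) (+ d)) ⟩
    ∣ N ℤ.+ + d ℤ.* (+ q ℤ.* + q) ∣    ≤⟨ ℤ.∣i+j∣≤∣i∣+∣j∣ N _ ⟩
    ∣ N ∣ + ∣ + d ℤ.* (+ q ℤ.* + q) ∣  ≡⟨ cong (∣ N ∣ ℕ.+_) (∣dqq∣ q) ⟩
    ∣ N ∣ + d * (q * q)                ∎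
    where
    open ℕ.≤-Reasoning
    N : ℤ
    N = norm d (+ p) (+ q)
    split : ∀ p q d → p ℤ.* p ≡ (p ℤ.* p ℤ.- d ℤ.* (q ℤ.* q)) ℤ.+ d ℤ.* (q ℤ.* q)
    split = ℤ-Solver.solve-∀

  norm≥ : ∀ p q → d * (q * q) ℕ.≤ p * p + ∣ norm d (+ p) (+ q) ∣
  norm≥ p q = begin
    d * (q * q)                ≡⟨ ∣dqq∣ q ⟨
    ∣ + d ℤ.* (+ q ℤ.* + q) ∣  ≡⟨ cong ∣_∣ (split (+ p) (+ q) (+ d)) ⟩
    ∣ + p ℤ.* + p ℤ.- N ∣      ≤⟨ ℤ.∣i-j∣≤∣i∣+∣j∣ (+ p ℤ.* + p) N ⟩
    ∣ + p ℤ.* + p ∣ + ∣ N ∣    ≡⟨ cong (ℕ._+ ∣ N ∣) (ℤ.abs-* (+ p) (+ p)) ⟩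
    p * p + ∣ N ∣              ∎
    where
    open ℕ.≤-Reasoning
    N : ℤ
    N = norm d (+ p) (+ q)
    split : ∀ p q d → d ℤ.* (q ℤ.* q) ≡ p ℤ.* p ℤ.- (p ℤ.* p ℤ.- d ℤ.* (q ℤ.* q))
    split = ℤ-Solver.solve-∀

  ∣p-nq∣<q : ∀ {p q} → k * q < p → p < (2 + k) * q → ∣ + p ℤ.- + (n * q) ∣ < q
  ∣p-nq∣<q {p} {q} lo hi = subst (_< q) (sym (cong ∣_∣ (ℤ.m-n≡m⊖n p (n * q)))) ∣p⊖nq∣<q
    where
    ∣p⊖nq∣<q : ∣ p ℤ.⊖ (n * q) ∣ < q
    ∣p⊖nq∣<q with ℕ.≤-total (n * q) p
    ... | inj₁ nq≤p = subst (_< q) (sym (cong ∣_∣ (ℤ.⊖-≥ nq≤p)))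
      (ℕ.+-cancelˡ-< (n * q) _ _ (subst₂ _<_ (sym (ℕ.m+[n∸m]≡n nq≤p)) (ℕ.+-comm q (n * q)) hi))
    ... | inj₂ p≤nq = subst (_< q) (sym (ℤ.∣⊖∣-≤ p≤nq))
      (ℕ.+-cancelʳ-< p _ _ (subst (_< q + p) (sym (ℕ.m∸n+n≡m p≤nq)) (ℕ.+-monoʳ-< q lo)))

  -- The step is (p + q√d)(n - √d) = -(p′ + q′√d) with q′ = p - n q and p′ = q - n q′,
  -- after p and q have been replaced by their absolute values.
  norm-descent : ∀ p q → ∣ norm d p q ∣ ℕ.≤ 2 →
    ∃[ r ] ∣ norm d p q ∣ ≡ r * r × (r ≡ 0 → p ≡ 0ℤ × q ≡ 0ℤ)
  norm-descent p q = <-rec P step ∣ q ∣ p q refl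
    where
    P : ℕ → Set
    P b = ∀ p q → ∣ q ∣ ≡ b → ∣ norm d p q ∣ ℕ.≤ 2 →
      ∃[ r ] ∣ norm d p q ∣ ≡ r * r × (r ≡ 0 → p ≡ 0ℤ × q ≡ 0ℤ)

    base : ∀ d p → p ℤ.* p ℤ.- d ℤ.* (0ℤ ℤ.* 0ℤ) ≡ p ℤ.* p
    base = ℤ-Solver.solve-∀

    unit : ∀ n p q → let q′ = p ℤ.- n ℤ.* q ; p′ = q ℤ.- n ℤ.* q′ in
      p′ ℤ.* p′ ℤ.- (+ 1 ℤ.+ n ℤ.* n) ℤ.* (q′ ℤ.* q′) ≡
      ℤ.- (p ℤ.* p ℤ.- (+ 1 ℤ.+ n ℤ.* n) ℤ.* (q ℤ.* q))
    unit = ℤ-Solver.solve-∀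

    -- The change of variables is invertible over ℤ, by q = p′ + n q′ and p = q′ + n q, so p′ = q′ =
    -- 0 leads back to p = q = 0.
    b-recovered : ∀ n p q → q ≡ (q ℤ.- n ℤ.* (p ℤ.- n ℤ.* q)) ℤ.+ n ℤ.* (p ℤ.- n ℤ.* q)
    b-recovered = ℤ-Solver.solve-∀

    a-recovered : ∀ n p q → p ≡ (p ℤ.- n ℤ.* q) ℤ.+ n ℤ.* q
    a-recovered = ℤ-Solver.solve-∀

    zeros : ∀ n x y z → x ≡ 0ℤ → y ≡ 0ℤ → z ≡ x ℤ.+ n ℤ.* y → z ≡ 0ℤ
    zeros n _ _ _ refl refl z≡ = trans z≡ (trans (ℤ.+-identityˡ _) (ℤ.*-zeroʳ n))

    step : ∀ b → (∀ {c} → c < b → P c) → P b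
    step zero rec p (+ zero) _ _ =
      ∣ p ∣ , trans (cong ∣_∣ (base (+ d) p)) (ℤ.abs-* p p) , λ ∣p∣≡0 → ℤ.∣i∣≡0⇒i≡0 ∣p∣≡0 , refl
    step b@(suc _) rec p q ∣q∣≡b small =
      let a = ∣ p ∣
          q′ = + a ℤ.- + n ℤ.* + b
          p′ = + b ℤ.- + n ℤ.* q′
          N≡ : norm d (+ a) (+ b) ≡ norm d p q
          N≡ = subst (λ b → norm d (+ a) (+ b) ≡ norm d p q) ∣q∣≡b (norm-abs p q)
          small′ = subst (λ z → ∣ z ∣ ℕ.≤ 2) (sym N≡) small
          N′≡ : norm d p′ q′ ≡ ℤ.- norm d (+ a) (+ b)
          N′≡ = subst
            (λ d → p′ ℤ.* p′ ℤ.- d ℤ.* (q′ ℤ.* q′) ≡ ℤ.- (+ a ℤ.* + a ℤ.- d ℤ.* (+ b ℤ.* + b)))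
            d≡ (unit (+ n) (+ a) (+ b))
          ∣N∣≡ : ∣ norm d p′ q′ ∣ ≡ ∣ norm d p q ∣
          ∣N∣≡ = trans (cong ∣_∣ N′≡) (trans (ℤ.∣-i∣≡∣i∣ (norm d (+ a) (+ b))) (cong ∣_∣ N≡))
          q′<b : ∣ q′ ∣ < b
          q′<b = subst (λ z → ∣ + a ℤ.- z ∣ < b) (ℤ.pos-* n b)
            (∣p-nq∣<q {a}
              (>-bound {a} (s≤s z≤n) small′ (norm≥ a b))
              (<-bound {a} (s≤s z≤n) small′ (norm≤ a b)))
          r , N≡r² , r≡0⇒ = rec q′<b p′ q′ refl (subst (ℕ._≤ 2) (sym ∣N∣≡) small)
      in r , trans (sym ∣N∣≡) N≡r² , λ r≡0 →
         let p′≡0 , q′≡0 = r≡0⇒ r≡0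
             b≡0 = zeros (+ n) p′ q′ (+ b) p′≡0 q′≡0 (b-recovered (+ n) (+ a) (+ b))
             a≡0 = zeros (+ n) q′ (+ b) (+ a) q′≡0 b≡0 (a-recovered (+ n) (+ a) (+ b))
         in ℤ.∣i∣≡0⇒i≡0 (ℤ.+-injective a≡0) , ℤ.∣i∣≡0⇒i≡0 (trans ∣q∣≡b (ℤ.+-injective b≡0))
      where
      d≡ : + 1 ℤ.+ + n ℤ.* + n ≡ + d
      d≡ = cong (λ z → + 1 ℤ.+ z) (sym (ℤ.pos-* n n))

-- Parity arguments for D ≡ 2 (mod 4).

even-square : ∀ {z w} → z ℤ.* z ≡ + 2 ℤ.* w → ∃[ t ] z ≡ + 2 ℤ.* t
even-square {z} {w} zz≡2w =
  let ℤˢ.divides t z≡t*2 = ℤˢ.∣ᵤ⇒∣ {+ 2} {z} 2∣z in t , trans z≡t*2 (ℤ.*-comm t (+ 2))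
  where
  2∣zz : 2 ∣ ∣ z ∣ * ∣ z ∣
  2∣zz = divides ∣ w ∣ (trans (sym (ℤ.abs-* z z))
    (trans (cong ∣_∣ zz≡2w) (trans (ℤ.abs-* (+ 2) w) (ℕ.*-comm 2 ∣ w ∣))))
  2∣z : 2 ∣ ∣ z ∣
  2∣z = [ id , id ]′ (euclidsLemma ∣ z ∣ ∣ z ∣ prime[2] 2∣zz)

-- t and n play the roles of the trace and the norm of (t + y√D) / 2.
both-even : ∀ {D} e t n y → + D ≡ + 2 ℤ.* (+ 1 ℤ.+ + 2 ℤ.* e) →
  t ℤ.* t ℤ.- + 4 ℤ.* n ≡ + D ℤ.* (y ℤ.* y) →
  (∃[ t′ ] t ≡ + 2 ℤ.* t′) × (∃[ y′ ] y ≡ + 2 ℤ.* y′)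
both-even {D} e t n y D≡ eq = (t′ , t≡) , even-square {y} yy≡
  where
  open ≡-Reasoning
  f : ℤ
  f = + 1 ℤ.+ + 2 ℤ.* e
  eq′ : t ℤ.* t ℤ.- + 4 ℤ.* n ≡ (+ 2 ℤ.* f) ℤ.* (y ℤ.* y)
  eq′ = trans eq (cong (ℤ._* (y ℤ.* y)) D≡)
  split : ∀ a b → a ≡ (a ℤ.- b) ℤ.+ b
  split = ℤ-Solver.solve-∀
  regroup : ∀ f y n →
    (+ 2 ℤ.* f) ℤ.* (y ℤ.* y) ℤ.+ + 4 ℤ.* n ≡ + 2 ℤ.* (f ℤ.* (y ℤ.* y) ℤ.+ + 2 ℤ.* n)
  regroup = ℤ-Solver.solve-∀
  t-even : ∃[ t′ ] t ≡ + 2 ℤ.* t′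
  t-even = even-square {t} {f ℤ.* (y ℤ.* y) ℤ.+ + 2 ℤ.* n}
    (trans (split (t ℤ.* t) (+ 4 ℤ.* n)) (trans (cong (ℤ._+ + 4 ℤ.* n) eq′) (regroup f y n)))
  t′ : ℤ
  t′ = proj₁ t-even
  t≡ : t ≡ + 2 ℤ.* t′
  t≡ = proj₂ t-even
  lhs : ∀ t n → + 2 ℤ.* (+ 2 ℤ.* (t ℤ.* t ℤ.- n)) ≡ (+ 2 ℤ.* t) ℤ.* (+ 2 ℤ.* t) ℤ.- + 4 ℤ.* n
  lhs = ℤ-Solver.solve-∀
  -- As t is even, the equation can be halved; f y² is then even with f odd, so y² is even.
  halved : + 2 ℤ.* (t′ ℤ.* t′ ℤ.- n) ≡ f ℤ.* (y ℤ.* y)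
  halved = ℤ.*-cancelˡ-≡ (+ 2) _ _ (trans (lhs t′ n)
    (trans (cong (λ t → t ℤ.* t ℤ.- + 4 ℤ.* n) (sym t≡)) (trans eq′ (ℤ.*-assoc (+ 2) f (y ℤ.* y)))))
  odd : ∀ e y → y ℤ.* y ≡ (+ 1 ℤ.+ + 2 ℤ.* e) ℤ.* (y ℤ.* y) ℤ.- + 2 ℤ.* (e ℤ.* (y ℤ.* y))
  odd = ℤ-Solver.solve-∀
  factor : ∀ a b → + 2 ℤ.* a ℤ.- + 2 ℤ.* b ≡ + 2 ℤ.* (a ℤ.- b)
  factor = ℤ-Solver.solve-∀
  yy≡ : y ℤ.* y ≡ + 2 ℤ.* ((t′ ℤ.* t′ ℤ.- n) ℤ.- e ℤ.* (y ℤ.* y))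
  yy≡ = trans (odd e y) (trans (cong (ℤ._- + 2 ℤ.* (e ℤ.* (y ℤ.* y))) (sym halved))
    (factor (t′ ℤ.* t′ ℤ.- n) (e ℤ.* (y ℤ.* y))))

-- Writing D = 2f, the coordinate 2r + Ds is even, hence N = 2M. Then M divides 2 and the odd number
-- f, so it is a unit. In the application u and v are the norms of the cofactors of 2 and √D.
∣norm∣≡2 : ∀ {D} e r s q u v → + D ≡ + 2 ℤ.* (+ 1 ℤ.+ + 2 ℤ.* e) →
  let N = norm D (+ 2 ℤ.* r ℤ.+ + D ℤ.* s) q in
  + 4 ≡ N ℤ.* u → ℤ.- + D ≡ N ℤ.* v → ∣ N ∣ ≡ 2
∣norm∣≡2 {D} e r s q u v D≡ 4≡Nu -D≡Nv =
  trans (cong ∣_∣ N≡2M) (trans (ℤ.abs-* (+ 2) M) (cong (2 *_) ∣M∣≡1))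
  where
  f N M : ℤ
  f = + 1 ℤ.+ + 2 ℤ.* e
  N = norm D (+ 2 ℤ.* r ℤ.+ + D ℤ.* s) q
  M = + 2 ℤ.* ((r ℤ.+ f ℤ.* s) ℤ.* (r ℤ.+ f ℤ.* s)) ℤ.- f ℤ.* (q ℤ.* q)
  expand : ∀ f r s q → let D = + 2 ℤ.* f ; p = + 2 ℤ.* r ℤ.+ D ℤ.* s in
    p ℤ.* p ℤ.- D ℤ.* (q ℤ.* q) ≡
    + 2 ℤ.* (+ 2 ℤ.* ((r ℤ.+ f ℤ.* s) ℤ.* (r ℤ.+ f ℤ.* s)) ℤ.- f ℤ.* (q ℤ.* q))
  expand = ℤ-Solver.solve-∀
  N≡2M : N ≡ + 2 ℤ.* M
  N≡2M = trans (cong (λ D → let p = + 2 ℤ.* r ℤ.+ D ℤ.* s in p ℤ.* p ℤ.- D ℤ.* (q ℤ.* q)) D≡)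
    (expand f r s q)
  2≡Mu : + 2 ≡ M ℤ.* u
  2≡Mu = ℤ.*-cancelˡ-≡ (+ 2) (+ 2) (M ℤ.* u)
    (trans 4≡Nu (trans (cong (ℤ._* u) N≡2M) (ℤ.*-assoc (+ 2) M u)))
  -f≡Mv : ℤ.- f ≡ M ℤ.* v
  -f≡Mv = ℤ.*-cancelˡ-≡ (+ 2) (ℤ.- f) (M ℤ.* v) (trans (sym (ℤ.neg-distribʳ-* (+ 2) f))
    (trans (cong ℤ.-_ (sym D≡)) (trans -D≡Nv (trans (cong (ℤ._* v) N≡2M) (ℤ.*-assoc (+ 2) M v)))))
  -- Bézout for the coprime pair f and 2: f - 2e = 1.
  one : ∀ e → ℤ.- (ℤ.- (+ 1 ℤ.+ + 2 ℤ.* e)) ℤ.- e ℤ.* + 2 ≡ + 1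
  one = ℤ-Solver.solve-∀
  factor : ∀ e M u v → M ℤ.* (ℤ.- v ℤ.- e ℤ.* u) ≡ ℤ.- (M ℤ.* v) ℤ.- e ℤ.* (M ℤ.* u)
  factor = ℤ-Solver.solve-∀
  M-unit : M ℤ.* (ℤ.- v ℤ.- e ℤ.* u) ≡ + 1
  M-unit = trans (factor e M u v)
    (trans (cong₂ (λ x y → ℤ.- x ℤ.- e ℤ.* y) (sym -f≡Mv) (sym 2≡Mu)) (one e))
  ∣M∣≡1 : ∣ M ∣ ≡ 1
  ∣M∣≡1 = ℕ.m*n≡1⇒m≡1 ∣ M ∣ ∣ ℤ.- v ℤ.- e ℤ.* u ∣ (trans (sym (ℤ.abs-* M _)) (cong ∣_∣ M-unit))

-- Integers inside ℚ and fractions in lowest terms.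

i*j≢0 : ∀ {i j} → i ≢ 0ℤ → j ≢ 0ℤ → i ℤ.* j ≢ 0ℤ
i*j≢0 {i} i≢0 j≢0 ij≡0 = [ i≢0 , j≢0 ]′ (ℤ.i*j≡0⇒i≡0∨j≡0 i ij≡0)

ℚ-ring : AlmostCommutativeRing 0ℓ 0ℓ
ℚ-ring = fromCommutativeRing ℚ.+-*-commutativeRing λ q → dec⇒maybe (0ℚ ℚ.≟ q)

ι : ℤ → ℚ
ι z = z ℚ./ 1

toℚᵘ-ι : ∀ z → toℚᵘ (ι z) ℚᵘ.≃ mkℚᵘ z 0
toℚᵘ-ι z = ℚ.toℚᵘ-fromℚᵘ (mkℚᵘ z 0)

ι-+ : ∀ a b → ι (a ℤ.+ b) ≡ ι a ℚ.+ ι b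
ι-+ a b = ℚ.toℚᵘ-injective (begin
  toℚᵘ (ι (a ℤ.+ b))          ≈⟨ toℚᵘ-ι (a ℤ.+ b) ⟩
  mkℚᵘ (a ℤ.+ b) 0            ≈⟨ *≡* (cong (ℤ._* + 1) (cong₂ ℤ._+_ (ℤ.*-identityʳ a) (ℤ.*-identityʳ b))) ⟨
  mkℚᵘ a 0 ℚᵘ.+ mkℚᵘ b 0      ≈⟨ ℚᵘ.+-cong (toℚᵘ-ι a) (toℚᵘ-ι b) ⟨
  toℚᵘ (ι a) ℚᵘ.+ toℚᵘ (ι b)  ≈⟨ ℚ.toℚᵘ-homo-+ (ι a) (ι b) ⟨
  toℚᵘ (ι a ℚ.+ ι b)          ∎)
  where open ℚᵘ.≃-Reasoning

ι-* : ∀ a b → ι (a ℤ.* b) ≡ ι a ℚ.* ι b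
ι-* a b = ℚ.toℚᵘ-injective (begin
  toℚᵘ (ι (a ℤ.* b))          ≈⟨ toℚᵘ-ι (a ℤ.* b) ⟩
  mkℚᵘ a 0 ℚᵘ.* mkℚᵘ b 0      ≈⟨ ℚᵘ.*-cong (toℚᵘ-ι a) (toℚᵘ-ι b) ⟨
  toℚᵘ (ι a) ℚᵘ.* toℚᵘ (ι b)  ≈⟨ ℚ.toℚᵘ-homo-* (ι a) (ι b) ⟨
  toℚᵘ (ι a ℚ.* ι b)          ∎)
  where open ℚᵘ.≃-Reasoning

ι-neg : ∀ a → ι (ℤ.- a) ≡ ℚ.- ι a
ι-neg a = ℚ.toℚᵘ-injective (begin
  toℚᵘ (ι (ℤ.- a))     ≈⟨ toℚᵘ-ι (ℤ.- a) ⟩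
  ℚᵘ.- mkℚᵘ a 0        ≈⟨ ℚᵘ.-‿cong (toℚᵘ-ι a) ⟨
  ℚᵘ.- toℚᵘ (ι a)      ≈⟨ ℚ.toℚᵘ-homo‿- (ι a) ⟨
  toℚᵘ (ℚ.- ι a)       ∎)
  where open ℚᵘ.≃-Reasoning

ι-injective : ∀ {a b} → ι a ≡ ι b → a ≡ b
ι-injective {a} {b} eq with ℚ.fromℚᵘ-injective {mkℚᵘ a 0} {mkℚᵘ b 0} eq
... | *≡* a*1≡b*1 = ℤ.*-cancelʳ-≡ a b (+ 1) a*1≡b*1

↧*p≡↥ : ∀ p → ι (↧ p) ℚ.* p ≡ ι (↥ p)
↧*p≡↥ p@(mkℚ _ _ _) = ℚ.toℚᵘ-injective (begin
  toℚᵘ (ι (↧ p) ℚ.* p)          ≈⟨ ℚ.toℚᵘ-homo-* (ι (↧ p)) p ⟩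
  toℚᵘ (ι (↧ p)) ℚᵘ.* toℚᵘ p    ≈⟨ ℚᵘ.*-congʳ {toℚᵘ p} (toℚᵘ-ι (↧ p)) ⟩
  mkℚᵘ (↧ p) 0 ℚᵘ.* toℚᵘ p      ≈⟨ *≡* cross ⟩
  mkℚᵘ (↥ p) 0                  ≈⟨ toℚᵘ-ι (↥ p) ⟨
  toℚᵘ (ι (↥ p))                ∎)
  where
  open ℚᵘ.≃-Reasoning
  cross : ↧ p ℤ.* ↥ p ℤ.* + 1 ≡ ↥ p ℤ.* + (1 * ↧ₙ p)
  cross = trans (ℤ.*-identityʳ (↧ p ℤ.* ↥ p)) (trans (ℤ.*-comm (↧ p) (↥ p))
    (cong (λ d → ↥ p ℤ.* + d) (sym (ℕ.*-identityˡ (↧ₙ p)))))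

↧-coprime-↥ : ∀ p → Coprime (↧ₙ p) ∣ ↥ p ∣
↧-coprime-↥ (mkℚ _ _ coprime) = Coprime.sym (Coprime.recompute coprime)

*-cancelˡ : ∀ r {p q} → r ≢ 0ℚ → r ℚ.* p ≡ r ℚ.* q → p ≡ q
*-cancelˡ r {p} {q} r≢0 eq = begin
  p                      ≡⟨ lem p ⟨
  ℚ.1/ r ℚ.* (r ℚ.* p)   ≡⟨ cong (ℚ.1/ r ℚ.*_) eq ⟩
  ℚ.1/ r ℚ.* (r ℚ.* q)   ≡⟨ lem q ⟩
  q                      ∎
  where
  open ≡-Reasoning
  instance
    r-nonZero : ℚ.NonZero r
    r-nonZero = ℚ.≢-nonZero r≢0
  lem : ∀ p → ℚ.1/ r ℚ.* (r ℚ.* p) ≡ p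
  lem p = trans (sym (ℚ.*-assoc (ℚ.1/ r) r p))
    (trans (cong (ℚ._* p) (ℚ.*-inverseˡ r)) (ℚ.*-identityˡ p))

-- Criteria for a rational number to be an integer.

IsInteger : ℚ → Set
IsInteger q = ∃[ z ] q ≡ ι z

↧ₙ≡1⇒integer : ∀ p → ↧ₙ p ≡ 1 → IsInteger p
↧ₙ≡1⇒integer p eq = ↥ p , trans (sym (ℚ.*-identityˡ p))
  (trans (cong (λ d → ι (+ d) ℚ.* p) (sym eq)) (↧*p≡↥ p))

-- For w = ±u/v in lowest terms, D u² = m v² with v prime to u forces v² to divide D. Used for w =
-- 2b, to control the denominator of the coefficient b of √D.
squarefree*square⇒integer : ∀ {D} → Squarefree D → 
  ∀ w → IsInteger (ι (+ D) ℚ.* (w ℚ.* w)) → IsInteger w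
squarefree*square⇒integer {D} sf w (M , Dww≡M) = ↧ₙ≡1⇒integer w (sf v (vv∣D v∣D))
  where
  u v m : ℕ
  u = ∣ ↥ w ∣
  v = ↧ₙ w
  m = ∣ M ∣
  v-u = ↧-coprime-↥ w

  eqℚ : ∀ D v w → D ℚ.* ((v ℚ.* w) ℚ.* (v ℚ.* w)) ≡ (D ℚ.* (w ℚ.* w)) ℚ.* (v ℚ.* v)
  eqℚ = solve-∀ ℚ-ring

  eqℤ : + D ℤ.* (↥ w ℤ.* ↥ w) ≡ M ℤ.* (↧ w ℤ.* ↧ w)
  eqℤ = ι-injective (begin
    ι (+ D ℤ.* (↥ w ℤ.* ↥ w))
      ≡⟨ trans (ι-* (+ D) _) (cong (ι (+ D) ℚ.*_) (ι-* (↥ w) (↥ w))) ⟩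
    ι (+ D) ℚ.* (ι (↥ w) ℚ.* ι (↥ w))                ≡⟨ cong (λ z → ι (+ D) ℚ.* (z ℚ.* z)) (↧*p≡↥ w) ⟨
    ι (+ D) ℚ.* ((ι (↧ w) ℚ.* w) ℚ.* (ι (↧ w) ℚ.* w)) ≡⟨ eqℚ (ι (+ D)) (ι (↧ w)) w ⟩
    (ι (+ D) ℚ.* (w ℚ.* w)) ℚ.* (ι (↧ w) ℚ.* ι (↧ w)) ≡⟨ cong₂ ℚ._*_ Dww≡M (sym (ι-* (↧ w) (↧ w))) ⟩
    ι M ℚ.* ι (↧ w ℤ.* ↧ w)                          ≡⟨ ι-* M (↧ w ℤ.* ↧ w) ⟨
    ι (M ℤ.* (↧ w ℤ.* ↧ w))                          ∎)
    where open ≡-Reasoning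

  abs₃ : ∀ a b c → ∣ a ℤ.* (b ℤ.* c) ∣ ≡ ∣ a ∣ * (∣ b ∣ * ∣ c ∣)
  abs₃ a b c = trans (ℤ.abs-* a (b ℤ.* c)) (cong (∣ a ∣ ℕ.*_) (ℤ.abs-* b c))

  eqℕ : D * (u * u) ≡ m * (v * v)
  eqℕ = trans (sym (abs₃ (+ D) (↥ w) (↥ w))) (trans (cong ∣_∣ eqℤ) (abs₃ M (↧ w) (↧ w)))

  cancel-uu : ∀ {d} → v ℕ.∣ d * (u * u) → v ℕ.∣ d
  cancel-uu {d} v∣ = Coprime.coprime-divisor v-u (Coprime.coprime-divisor v-u
    (subst (v ℕ.∣_) (trans (ℕ.*-comm d (u * u)) (ℕ.*-assoc u u d)) v∣))

  v∣D : v ℕ.∣ D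
  v∣D = cancel-uu (subst (v ℕ.∣_) (sym eqℕ) (ℕ.∣n⇒∣m*n m (ℕ.m∣m*n v)))

  -- With D = k v, cancelling one v from k v u² = m v² leaves k u² = m v, so v divides k as well.
  vv∣D : v ℕ.∣ D → v * v ℕ.∣ D
  vv∣D (ℕ.divides k D≡kv) = subst (v * v ℕ.∣_) (sym D≡kv) (ℕ.*-monoˡ-∣ v (cancel-uu {k} (ℕ.divides m
    (ℕ.*-cancelʳ-≡ _ _ v (begin
      k * (u * u) * v ≡⟨ ℕ.*-assoc k (u * u) v ⟩
      k * (u * u * v) ≡⟨ cong (k ℕ.*_) (ℕ.*-comm (u * u) v) ⟩
      k * (v * (u * u)) ≡⟨ ℕ.*-assoc k v _ ⟨
      k * v * (u * u) ≡⟨ cong (ℕ._* (u * u)) D≡kv ⟨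
      D * (u * u)       ≡⟨ eqℕ ⟩
      m * (v * v)       ≡⟨ ℕ.*-assoc m v v ⟨
      m * v * v         ∎)))))
    where open ≡-Reasoning

coprime-* : ∀ {m n o} → Coprime m n → Coprime m o → Coprime m (n * o)
coprime-* c₁ c₂ (d∣m , d∣no) =
  c₂ (d∣m , Coprime.coprime-divisor (λ (e∣d , e∣n) → c₁ (ℕ.∣-trans e∣d d∣m , e∣n)) d∣no)

coprime-^ʳ : ∀ {m n} k → Coprime m n → Coprime m (n ^ k)
coprime-^ʳ zero    c = Coprime.sym (Coprime.1-coprimeTo _)
coprime-^ʳ (suc k) c = coprime-* c (coprime-^ʳ k c)

coprime-^ : ∀ {m n} k → Coprime m n → Coprime (m ^ k) (n ^ k)
coprime-^ k c = Coprime.sym (coprime-^ʳ k (Coprime.sym (coprime-^ʳ k c)))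

n<2^n : ∀ n → n < 2 ^ n
n<2^n zero    = s≤s z≤n
n<2^n (suc n) = subst (suc (suc n) ℕ.≤_) (cong (2 ^ n ℕ.+_) (sym (ℕ.+-identityʳ _)))
  (ℕ.+-mono-≤ (ℕ.≤-trans (s≤s z≤n) (n<2^n n)) (n<2^n n))

-- Coprimality makes every v^k divide E. The exponent k = E is large enough: v ≥ 2 would give v^E ≥
-- 2^E > E.
powers-divide⇒≡1 : ∀ {E v u} → .{{ℕ.NonZero E}} → .{{ℕ.NonZero v}} → Coprime v u →
  (∀ k → v ^ k ℕ.∣ E * u ^ k) → v ≡ 1
powers-divide⇒≡1 {E} {v} {u} v-u v^k∣ with v ℕ.≤? 1
... | yes v≤1 = ℕ.≤-antisym v≤1 (ℕ.>-nonZero⁻¹ v)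
... | no  v≰1 = contradiction (ℕ.∣⇒≤ v^E∣E)
  (ℕ.<⇒≱ (ℕ.<-≤-trans (n<2^n E) (ℕ.^-monoˡ-≤ E (ℕ.≰⇒> v≰1))))
  where
  v^E∣E : v ^ E ℕ.∣ E
  v^E∣E = Coprime.coprime-divisor (coprime-^ E v-u) (subst (v ^ E ℕ.∣_) (ℕ.*-comm E _) (v^k∣ E))

-- Algebra in K = ℚ(√D).

module Arithmetic (D : ℕ) where
  open QuadraticField D renaming (_+_ to _+ᴷ_; _*_ to _*ᴷ_)

  δ : ℚ
  δ = ι (+ D)

  -- `K` comes with addition and multiplication only, so the solver is given a semiring. Its laws
  -- are polynomial identities over ℚ in which `δ` is a variable.
  +ᴷ-*ᴷ-commutativeSemiring : CommutativeSemiring 0ℓ 0ℓ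
  +ᴷ-*ᴷ-commutativeSemiring = record
    { Carrier = K ; _≈_ = _≡_ ; _+_ = _+ᴷ_ ; _*_ = _*ᴷ_ ; 0# = 0K ; 1# = 1K
    ; isCommutativeSemiring = isCommutativeSemiringˡ record
      { +-isCommutativeMonoid = record
        { isMonoid = record
          { isSemigroup = record
            { isMagma = record { isEquivalence = isEquivalence ; ∙-cong = cong₂ _+ᴷ_ }
            ; assoc = λ (a +√ b) (c +√ d) (e +√ f) → cong₂ _+√_ (ℚ.+-assoc a c e) (ℚ.+-assoc b d f)
            }
          ; identity = (λ (a +√ b) → cong₂ _+√_ (ℚ.+-identityˡ a) (ℚ.+-identityˡ b))
                     , (λ (a +√ b) → cong₂ _+√_ (ℚ.+-identityʳ a) (ℚ.+-identityʳ b))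
          }
        ; comm = λ (a +√ b) (c +√ d) → cong₂ _+√_ (ℚ.+-comm a c) (ℚ.+-comm b d)
        }
      ; *-isCommutativeMonoid = record
        { isMonoid = record
          { isSemigroup = record
            { isMagma = record { isEquivalence = isEquivalence ; ∙-cong = cong₂ _*ᴷ_ }
            ; assoc = λ (a +√ b) (c +√ d) (e +√ f) →
                cong₂ _+√_ (assoc₁ δ a b c d e f) (assoc₂ δ a b c d e f)
            }
          ; identity = (λ (a +√ b) → cong₂ _+√_ (identityˡ₁ δ a b) (identityˡ₂ a b))
                     , (λ (a +√ b) → cong₂ _+√_ (identityʳ₁ δ a b) (identityʳ₂ a b))
          }
        ; comm = λ (a +√ b) (c +√ d) → cong₂ _+√_ (comm₁ δ a b c d) (comm₂ a b c d)
        }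
      ; distribʳ = λ (a +√ b) (c +√ d) (e +√ f) →
          cong₂ _+√_ (distribʳ₁ δ a b c d e f) (distribʳ₂ a b c d e f)
      ; zeroˡ = λ (a +√ b) → cong₂ _+√_ (zeroˡ₁ δ a b) (zeroˡ₂ a b)
      }
    }
    where
    assoc₁ : ∀ δ a b c d e f →
      (a ℚ.* c ℚ.+ δ ℚ.* (b ℚ.* d)) ℚ.* e ℚ.+ δ ℚ.* ((a ℚ.* d ℚ.+ b ℚ.* c) ℚ.* f)
      ≡ a ℚ.* (c ℚ.* e ℚ.+ δ ℚ.* (d ℚ.* f)) ℚ.+ δ ℚ.* (b ℚ.* (c ℚ.* f ℚ.+ d ℚ.* e))
    assoc₁ = solve-∀ ℚ-ring
    assoc₂ : ∀ δ a b c d e f →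
      (a ℚ.* c ℚ.+ δ ℚ.* (b ℚ.* d)) ℚ.* f ℚ.+ (a ℚ.* d ℚ.+ b ℚ.* c) ℚ.* e
      ≡ a ℚ.* (c ℚ.* f ℚ.+ d ℚ.* e) ℚ.+ b ℚ.* (c ℚ.* e ℚ.+ δ ℚ.* (d ℚ.* f))
    assoc₂ = solve-∀ ℚ-ring
    identityˡ₁ : ∀ δ a b → 1ℚ ℚ.* a ℚ.+ δ ℚ.* (0ℚ ℚ.* b) ≡ a
    identityˡ₁ = solve-∀ ℚ-ring
    identityˡ₂ : ∀ a b → 1ℚ ℚ.* b ℚ.+ 0ℚ ℚ.* a ≡ b
    identityˡ₂ = solve-∀ ℚ-ring
    identityʳ₁ : ∀ δ a b → a ℚ.* 1ℚ ℚ.+ δ ℚ.* (b ℚ.* 0ℚ) ≡ a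
    identityʳ₁ = solve-∀ ℚ-ring
    identityʳ₂ : ∀ a b → a ℚ.* 0ℚ ℚ.+ b ℚ.* 1ℚ ≡ b
    identityʳ₂ = solve-∀ ℚ-ring
    comm₁ : ∀ δ a b c d → a ℚ.* c ℚ.+ δ ℚ.* (b ℚ.* d) ≡ c ℚ.* a ℚ.+ δ ℚ.* (d ℚ.* b)
    comm₁ = solve-∀ ℚ-ring
    comm₂ : ∀ a b c d → a ℚ.* d ℚ.+ b ℚ.* c ≡ c ℚ.* b ℚ.+ d ℚ.* a
    comm₂ = solve-∀ ℚ-ring
    distribʳ₁ : ∀ δ a b c d e f →
      (c ℚ.+ e) ℚ.* a ℚ.+ δ ℚ.* ((d ℚ.+ f) ℚ.* b) ≡
      (c ℚ.* a ℚ.+ δ ℚ.* (d ℚ.* b)) ℚ.+ (e ℚ.* a ℚ.+ δ ℚ.* (f ℚ.* b))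
    distribʳ₁ = solve-∀ ℚ-ring
    distribʳ₂ : ∀ a b c d e f →
      (c ℚ.+ e) ℚ.* b ℚ.+ (d ℚ.+ f) ℚ.* a ≡ (c ℚ.* b ℚ.+ d ℚ.* a) ℚ.+ (e ℚ.* b ℚ.+ f ℚ.* a)
    distribʳ₂ = solve-∀ ℚ-ring
    zeroˡ₁ : ∀ δ a b → 0ℚ ℚ.* a ℚ.+ δ ℚ.* (0ℚ ℚ.* b) ≡ 0ℚ
    zeroˡ₁ = solve-∀ ℚ-ring
    zeroˡ₂ : ∀ a b → 0ℚ ℚ.* b ℚ.+ 0ℚ ℚ.* a ≡ 0ℚ
    zeroˡ₂ = solve-∀ ℚ-ring

  module Kₛ = CommutativeSemiring +ᴷ-*ᴷ-commutativeSemiring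
  module KSolver = SemiringSolver +ᴷ-*ᴷ-commutativeSemiring

  -- The order ℤ[√D].

  infix 5 _+√ℤ_
  _+√ℤ_ : ℤ → ℤ → K
  p +√ℤ q = ι p +√ ι q

  -- Membership in ℤ[√D], which is the whole ring of integers for squarefree D ≡ 2 (mod 4); the
  -- inclusion of 𝒪 in it is `integral⇒order`.
  Order : K → Set
  Order α = ∃[ p ] ∃[ q ] α ≡ p +√ℤ q

  +√ℤ-+ : ∀ p q r s → (p +√ℤ q) +ᴷ (r +√ℤ s) ≡ p ℤ.+ r +√ℤ q ℤ.+ s
  +√ℤ-+ p q r s = sym (cong₂ _+√_ (ι-+ p r) (ι-+ q s))

  +√ℤ-* : ∀ p q r s → (p +√ℤ q) *ᴷ (r +√ℤ s) ≡ p ℤ.* r ℤ.+ + D ℤ.* (q ℤ.* s) +√ℤ p ℤ.* s ℤ.+ q ℤ.* r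
  +√ℤ-* p q r s = sym (cong₂ _+√_
    (trans (ι-+ (p ℤ.* r) _) (cong₂ ℚ._+_ (ι-* p r) (trans (ι-* (+ D) _) (cong (δ ℚ.*_) (ι-* q s)))))
    (trans (ι-+ (p ℤ.* s) _) (cong₂ ℚ._+_ (ι-* p s) (ι-* q r))))

  order-+ : ∀ {x y} → Order x → Order y → Order (x +ᴷ y)
  order-+ (p , q , refl) (r , s , refl) = p ℤ.+ r , q ℤ.+ s , +√ℤ-+ p q r s

  order-* : ∀ {x y} → Order x → Order y → Order (x *ᴷ y)
  order-* (p , q , refl) (r , s , refl) =
    p ℤ.* r ℤ.+ + D ℤ.* (q ℤ.* s) , p ℤ.* s ℤ.+ q ℤ.* r , +√ℤ-* p q r s

  order-cancelˡ : ∀ {x y} → Order x → Order (x +ᴷ y) → Order y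
  order-cancelˡ {x} {c +√ d} (p , q , refl) (r , s , eq) =
    r ℤ.- p , s ℤ.- q , cong₂ _+√_ (lem p c r (cong K.rat eq)) (lem q d s (cong K.irr eq))
    where
    undo : ∀ x y → y ≡ (x ℚ.+ y) ℚ.+ ℚ.- x
    undo = solve-∀ ℚ-ring
    lem : ∀ p c r → ι p ℚ.+ c ≡ ι r → c ≡ ι (r ℤ.- p)
    lem p c r eq = trans (undo (ι p) c) (trans (cong₂ ℚ._+_ eq (sym (ι-neg p))) (sym (ι-+ r (ℤ.- p))))

  order-ℤ : ∀ c → Order (fromℤ c)
  order-ℤ c = c , 0ℤ , refl

  -- Almost integral elements.

  infixr 8 _^ᴷ_
  _^ᴷ_ : K → ℕ → K
  α ^ᴷ zero  = 1K
  α ^ᴷ suc k = α *ᴷ α ^ᴷ k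

  ^ᴷ-+ : ∀ α j k → α ^ᴷ (j + k) ≡ α ^ᴷ j *ᴷ α ^ᴷ k
  ^ᴷ-+ α zero    k = sym (Kₛ.*-identityˡ _)
  ^ᴷ-+ α (suc j) k = trans (cong (α *ᴷ_) (^ᴷ-+ α j k)) (sym (Kₛ.*-assoc α _ _))

  fromℚ-* : ∀ q α → fromℚ q *ᴷ α ≡ q ℚ.* K.rat α +√ q ℚ.* K.irr α
  fromℚ-* q (a +√ b) = cong₂ _+√_ (lem₁ δ q a b) (lem₂ q a b)
    where
    lem₁ : ∀ δ q a b → q ℚ.* a ℚ.+ δ ℚ.* (0ℚ ℚ.* b) ≡ q ℚ.* a
    lem₁ = solve-∀ ℚ-ring
    lem₂ : ∀ q a b → q ℚ.* b ℚ.+ 0ℚ ℚ.* a ≡ q ℚ.* b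
    lem₂ = solve-∀ ℚ-ring

  fromℤ-* : ∀ c d → fromℤ (c ℤ.* d) ≡ fromℤ c *ᴷ fromℤ d
  fromℤ-* c d = sym (trans (fromℚ-* (ι c) (fromℤ d)) (cong₂ _+√_ (sym (ι-* c d)) (ℚ.*-zeroʳ (ι c))))

  -- In contrast to Integral, this is closed under sums and products by a direct
  -- computation, which gives the integrality of traces and norms.
  AlmostIntegral : K → Set
  AlmostIntegral α = ∃[ E ] E ≢ 0ℤ × (∀ k → Order (fromℤ E *ᴷ α ^ᴷ k))

  denominator : ∀ α → ∃[ e ] e ≢ 0ℤ × Order (fromℤ e *ᴷ α)
  denominator (a +√ b) = ↧ a ℤ.* ↧ b , i*j≢0 {↧ a} {↧ b} (λ ()) (λ ()) ,
    ↧ b ℤ.* ↥ a , ↧ a ℤ.* ↥ b ,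
    trans (fromℚ-* (ι (↧ a ℤ.* ↧ b)) (a +√ b)) (cong₂ _+√_
      (trans (cong (ℚ._* a) (cong ι (ℤ.*-comm (↧ a) (↧ b)))) (lem (↧ b) a))
      (lem (↧ a) b))
    where
    lem : ∀ c p → ι (c ℤ.* ↧ p) ℚ.* p ≡ ι (c ℤ.* ↥ p)
    lem c p = begin
      ι (c ℤ.* ↧ p) ℚ.* p        ≡⟨ cong (ℚ._* p) (ι-* c (↧ p)) ⟩
      ι c ℚ.* ι (↧ p) ℚ.* p      ≡⟨ ℚ.*-assoc (ι c) _ p ⟩
      ι c ℚ.* (ι (↧ p) ℚ.* p)    ≡⟨ cong (ι c ℚ.*_) (↧*p≡↥ p) ⟩
      ι c ℚ.* ι (↥ p)            ≡⟨ ι-* c (↥ p) ⟨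
      ι (c ℤ.* ↥ p)              ∎
      where open ≡-Reasoning

  common-denominator : ∀ α m → ∃[ E ] E ≢ 0ℤ × (∀ {j} → j ℕ.≤ m → Order (fromℤ E *ᴷ α ^ᴷ j))
  common-denominator α zero    = 1ℤ , (λ ()) , λ { z≤n → order-* (order-ℤ 1ℤ) (order-ℤ 1ℤ) }
  common-denominator α (suc m) =
    let E , E≢0 , ordE = common-denominator α m
        e , e≢0 , orde = denominator α
    in E ℤ.* e , i*j≢0 E≢0 e≢0 , λ
      { z≤n → order-* (order-ℤ (E ℤ.* e)) (order-ℤ 1ℤ)
      ; (s≤s {j} j≤m) → subst Order
          (trans (lem (fromℤ E) (fromℤ e) α (α ^ᴷ j)) (cong (_*ᴷ (α *ᴷ α ^ᴷ j)) (sym (fromℤ-* E e))))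
          (order-* (ordE j≤m) orde) }
    where
    open KSolver
    lem : ∀ E e α x → (E *ᴷ x) *ᴷ (e *ᴷ α) ≡ (E *ᴷ e) *ᴷ (α *ᴷ x)
    lem = solve 4 (λ E e α x → (E :* x) :* (e :* α) := (E :* e) :* (α :* x)) refl

  -- Solves the monic equation, multiplied by E z, for its leading term. Removing the constant
  -- coefficient c subtracts c E z, which lies in ℤ[√D], and what remains has z α in place of z.
  horner : ∀ E α cs z →
    (∀ {j} → j < length cs → Order (E *ᴷ (z *ᴷ α ^ᴷ j))) →
    Order (E *ᴷ (z *ᴷ evalMonic cs α)) →
    Order (E *ᴷ (z *ᴷ α ^ᴷ length cs))
  horner E α []       z low all = all
  horner E α (c ∷ cs) z low all = subst Order (assoc E z α (α ^ᴷ length cs))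
    (horner E α cs (z *ᴷ α)
      (λ {j} j< → subst Order (sym (assoc E z α (α ^ᴷ j))) (low (s≤s j<)))
      (order-cancelˡ
        (order-* (order-ℤ c) (low {zero} (s≤s z≤n)))
        (subst Order (split E z (fromℤ c) α (evalMonic cs α)) all)))
    where
    open KSolver
    assoc : ∀ E z α x → E *ᴷ ((z *ᴷ α) *ᴷ x) ≡ E *ᴷ (z *ᴷ (α *ᴷ x))
    assoc E z α x = cong (E *ᴷ_) (Kₛ.*-assoc z α x)
    split : ∀ E z c α x → E *ᴷ (z *ᴷ (c +ᴷ α *ᴷ x)) ≡ c *ᴷ (E *ᴷ (z *ᴷ 1K)) +ᴷ E *ᴷ ((z *ᴷ α) *ᴷ x)
    split = solve 5 (λ E z c α x →
      E :* (z :* (c :+ α :* x)) := c :* (E :* (z :* con 1)) :+ E :* ((z :* α) :* x)) refl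

  -- E is a common denominator of 1, α, ..., α^m, with m the degree of the equation. For k > m the
  -- equation times α^(k-m) expresses α^k through lower powers with integer coefficients, so the
  -- same E works.
  integral⇒almostIntegral : ∀ {α} → Integral α → AlmostIntegral α
  integral⇒almostIntegral {α} (cs , root) with common-denominator α (length cs)
  ... | E , E≢0 , low = E , E≢0 , <-rec P step
    where
    m = length cs
    P : ℕ → Set
    P k = Order (fromℤ E *ᴷ α ^ᴷ k)
    step : ∀ k → (∀ {j} → j < k → P j) → P k
    step k rec with k ℕ.≤? m
    ... | yes k≤m = low k≤m
    ... | no  k≰m = subst P (ℕ.m∸n+n≡m m≤k) (subst Order (cong (fromℤ E *ᴷ_) (sym (^ᴷ-+ α k′ m)))
        (horner (fromℤ E) α cs (α ^ᴷ k′)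
          (λ {j} j<m → subst Order (cong (fromℤ E *ᴷ_) (^ᴷ-+ α k′ j))
            (rec (subst (k′ + j ℕ.<_) (ℕ.m∸n+n≡m m≤k) (ℕ.+-monoʳ-< k′ j<m))))
          (subst Order (sym (trans (cong (λ x → fromℤ E *ᴷ (α ^ᴷ k′ *ᴷ x)) root)
              (trans (cong (fromℤ E *ᴷ_) (Kₛ.zeroʳ (α ^ᴷ k′))) (Kₛ.zeroʳ (fromℤ E))))) (order-ℤ 0ℤ))))
      where
      m≤k = ℕ.<⇒≤ (ℕ.≰⇒> k≰m)
      k′ = k ℕ.∸ m

  private
    swap : ∀ α β x y → (α *ᴷ β) *ᴷ (x *ᴷ y) ≡ (α *ᴷ x) *ᴷ (β *ᴷ y)
    swap = KSolver.solve 4 (λ α β x y → (α :* β) :* (x :* y) := (α :* x) :* (β :* y)) refl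
      where open KSolver

  almostIntegral-* : ∀ {α β} → AlmostIntegral α → AlmostIntegral β → AlmostIntegral (α *ᴷ β)
  almostIntegral-* {α} {β} (E , E≢0 , ordα) (F , F≢0 , ordβ) = E ℤ.* F , i*j≢0 E≢0 F≢0 , λ k →
    subst Order
      (trans (swap (fromℤ E) (α ^ᴷ k) (fromℤ F) (β ^ᴷ k))
             (sym (cong₂ _*ᴷ_ (fromℤ-* E F) (^-*-distrib k))))
      (order-* (ordα k) (ordβ k))
    where
    ^-*-distrib : ∀ k → (α *ᴷ β) ^ᴷ k ≡ α ^ᴷ k *ᴷ β ^ᴷ k
    ^-*-distrib zero    = sym (Kₛ.*-identityˡ 1K)
    ^-*-distrib (suc k) = trans (cong ((α *ᴷ β) *ᴷ_) (^-*-distrib k)) (swap α β (α ^ᴷ k) (β ^ᴷ k))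

  -- E F clears the denominators of all monomials α^i β^j at once, hence of their combination (α +
  -- β)^k.
  almostIntegral-+ : ∀ {α β} → AlmostIntegral α → AlmostIntegral β → AlmostIntegral (α +ᴷ β)
  almostIntegral-+ {α} {β} (E , E≢0 , ordα) (F , F≢0 , ordβ) = E ℤ.* F , i*j≢0 E≢0 F≢0 , λ k →
    subst Order
      (trans (drop-1 (fromℤ E *ᴷ fromℤ F) ((α +ᴷ β) ^ᴷ k))
             (cong (_*ᴷ (α +ᴷ β) ^ᴷ k) (sym (fromℤ-* E F))))
      (go k 0 0)
    where
    open KSolver
    drop-1 : ∀ E x → E *ᴷ (x *ᴷ (1K *ᴷ 1K)) ≡ E *ᴷ x
    drop-1 = solve 2 (λ E x → E :* (x :* (con 1 :* con 1)) := E :* x) refl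
    lem : ∀ E F x y → (E *ᴷ x) *ᴷ (F *ᴷ y) ≡ (E *ᴷ F) *ᴷ (1K *ᴷ (x *ᴷ y))
    lem = solve 4 (λ E F x y → (E :* x) :* (F :* y) := (E :* F) :* (con 1 :* (x :* y))) refl
    expand : ∀ E α β s x y →
      E *ᴷ (s *ᴷ ((α *ᴷ x) *ᴷ y)) +ᴷ E *ᴷ (s *ᴷ (x *ᴷ (β *ᴷ y))) ≡ E *ᴷ (((α +ᴷ β) *ᴷ s) *ᴷ (x *ᴷ y))
    expand = solve 6 (λ E α β s x y →
      E :* (s :* ((α :* x) :* y)) :+ E :* (s :* (x :* (β :* y))) := E :* (((α :+ β) :* s) :* (x :* y))) refl
    -- The power is expanded one factor at a time, the factors already chosen being collected in α^i
    -- β^j; this avoids binomial coefficients.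
    go : ∀ k i j → Order ((fromℤ E *ᴷ fromℤ F) *ᴷ ((α +ᴷ β) ^ᴷ k *ᴷ (α ^ᴷ i *ᴷ β ^ᴷ j)))
    go zero    i j = subst Order (lem (fromℤ E) (fromℤ F) (α ^ᴷ i) (β ^ᴷ j))
      (order-* (ordα i) (ordβ j))
    go (suc k) i j = subst Order (expand (fromℤ E *ᴷ fromℤ F) α β ((α +ᴷ β) ^ᴷ k) (α ^ᴷ i) (β ^ᴷ j))
      (order-+ (go k (suc i) j) (go k i (suc j)))

  -- Conjugation, and almost integral rationals.

  conj : K → K
  conj (a +√ b) = a +√ ℚ.- b

  conj-* : ∀ α β → conj (α *ᴷ β) ≡ conj α *ᴷ conj β
  conj-* (a +√ b) (c +√ d) = cong₂ _+√_ (lem₁ δ a b c d) (lem₂ a b c d)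
    where
    lem₁ : ∀ δ a b c d → a ℚ.* c ℚ.+ δ ℚ.* (b ℚ.* d) ≡ a ℚ.* c ℚ.+ δ ℚ.* (ℚ.- b ℚ.* ℚ.- d)
    lem₁ = solve-∀ ℚ-ring
    lem₂ : ∀ a b c d → ℚ.- (a ℚ.* d ℚ.+ b ℚ.* c) ≡ a ℚ.* ℚ.- d ℚ.+ ℚ.- b ℚ.* c
    lem₂ = solve-∀ ℚ-ring

  conj-^ : ∀ α k → conj (α ^ᴷ k) ≡ conj α ^ᴷ k
  conj-^ α zero    = refl
  conj-^ α (suc k) = trans (conj-* α (α ^ᴷ k)) (cong (conj α *ᴷ_) (conj-^ α k))

  order-conj : ∀ {α} → Order α → Order (conj α)
  order-conj (p , q , refl) = p , ℤ.- q , cong (ι p +√_) (sym (ι-neg q))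

  almostIntegral-conj : ∀ {α} → AlmostIntegral α → AlmostIntegral (conj α)
  almostIntegral-conj {α} (E , E≢0 , ord) = E , E≢0 , λ k → subst Order
    (trans (conj-* (fromℤ E) (α ^ᴷ k)) (cong (fromℤ E *ᴷ_) (conj-^ α k)))
    (order-conj (ord k))

  -- For q = u / v in lowest terms, E q^k ∈ ℤ forces v^k ∣ E, for every k.
  almostIntegral-ℚ⇒integer : ∀ {q} → AlmostIntegral (fromℚ q) → IsInteger q
  almostIntegral-ℚ⇒integer {q} (E , E≢0 , ord) = ↧ₙ≡1⇒integer q
    (powers-divide⇒≡1 {∣ E ∣} {↧ₙ q} {{ℕ.≢-nonZero λ ∣E∣≡0 → E≢0 (ℤ.∣i∣≡0⇒i≡0 ∣E∣≡0)}}
      (↧-coprime-↥ q) divides-power)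
    where
    open KSolver
    rotate : ∀ a b c → a *ᴷ (b *ᴷ c) ≡ b *ᴷ (a *ᴷ c)
    rotate = solve 3 (λ a b c → a :* (b :* c) := b :* (a :* c)) refl

    clear : ∀ k → fromℤ (↧ q ℤ.^ k) *ᴷ fromℚ q ^ᴷ k ≡ fromℤ (↥ q ℤ.^ k)
    clear zero    = Kₛ.*-identityˡ 1K
    clear (suc k) = begin
      fromℤ (v ℤ.* v ℤ.^ k) *ᴷ (Q *ᴷ Q ^ᴷ k)
        ≡⟨ cong (_*ᴷ (Q *ᴷ Q ^ᴷ k)) (fromℤ-* v (v ℤ.^ k)) ⟩
      (fromℤ v *ᴷ fromℤ (v ℤ.^ k)) *ᴷ (Q *ᴷ Q ^ᴷ k)
        ≡⟨ swap (fromℤ v) (fromℤ (v ℤ.^ k)) Q (Q ^ᴷ k) ⟩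
      (fromℤ v *ᴷ Q) *ᴷ (fromℤ (v ℤ.^ k) *ᴷ Q ^ᴷ k)
        ≡⟨ cong₂ _*ᴷ_ clear₁ (clear k) ⟩
      fromℤ (↥ q) *ᴷ fromℤ (↥ q ℤ.^ k)
        ≡⟨ fromℤ-* (↥ q) (↥ q ℤ.^ k) ⟨
      fromℤ (↥ q ℤ.* ↥ q ℤ.^ k) ∎
      where
      open ≡-Reasoning
      v : ℤ
      v = ↧ q
      Q : K
      Q = fromℚ q
      clear₁ : fromℤ v *ᴷ Q ≡ fromℤ (↥ q)
      clear₁ = trans (fromℚ-* (ι v) Q) (cong₂ _+√_ (↧*p≡↥ q) (ℚ.*-zeroʳ (ι v)))

    abs-^ : ∀ z k → ∣ z ℤ.^ k ∣ ≡ ∣ z ∣ ^ k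
    abs-^ z zero    = refl
    abs-^ z (suc k) = trans (ℤ.abs-* z (z ℤ.^ k)) (cong (∣ z ∣ *_) (abs-^ z k))

    divides-power : ∀ k → ↧ₙ q ^ k ℕ.∣ ∣ E ∣ * ∣ ↥ q ∣ ^ k
    divides-power k with ord k
    ... | z , w , Eq^k≡ = ℕ.divides ∣ z ∣ (begin
      ∣ E ∣ * ∣ ↥ q ∣ ^ k     ≡⟨ trans (ℤ.abs-* E _) (cong (∣ E ∣ *_) (abs-^ (↥ q) k)) ⟨
      ∣ E ℤ.* ↥ q ℤ.^ k ∣       ≡⟨ cong ∣_∣ eqℤ ⟩
      ∣ ↧ q ℤ.^ k ℤ.* z ∣       ≡⟨ trans (ℤ.abs-* (↧ q ℤ.^ k) z) (cong (_* ∣ z ∣) (abs-^ (↧ q) k)) ⟩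
      ↧ₙ q ^ k * ∣ z ∣        ≡⟨ ℕ.*-comm (↧ₙ q ^ k) ∣ z ∣ ⟩
      ∣ z ∣ * ↧ₙ q ^ k        ∎)
      where
      open ≡-Reasoning
      eqℤ : E ℤ.* ↥ q ℤ.^ k ≡ ↧ q ℤ.^ k ℤ.* z
      eqK : fromℤ (E ℤ.* ↥ q ℤ.^ k) ≡ ι (↧ q ℤ.^ k ℤ.* z) +√ ι (↧ q ℤ.^ k) ℚ.* ι w
      eqK = begin
        fromℤ (E ℤ.* ↥ q ℤ.^ k)                              ≡⟨ fromℤ-* E (↥ q ℤ.^ k) ⟩
        fromℤ E *ᴷ fromℤ (↥ q ℤ.^ k)                         ≡⟨ cong (fromℤ E *ᴷ_) (clear k) ⟨
        fromℤ E *ᴷ (fromℤ (↧ q ℤ.^ k) *ᴷ fromℚ q ^ᴷ k)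
          ≡⟨ rotate (fromℤ E) (fromℤ (↧ q ℤ.^ k)) (fromℚ q ^ᴷ k) ⟩
        fromℤ (↧ q ℤ.^ k) *ᴷ (fromℤ E *ᴷ fromℚ q ^ᴷ k)       ≡⟨ cong (fromℤ (↧ q ℤ.^ k) *ᴷ_) Eq^k≡ ⟩
        fromℤ (↧ q ℤ.^ k) *ᴷ (z +√ℤ w)                       ≡⟨ fromℚ-* (ι (↧ q ℤ.^ k)) (z +√ℤ w) ⟩
        ι (↧ q ℤ.^ k) ℚ.* ι z +√ ι (↧ q ℤ.^ k) ℚ.* ι w       ≡⟨ cong (_+√ _) (ι-* (↧ q ℤ.^ k) z) ⟨
        ι (↧ q ℤ.^ k ℤ.* z) +√ ι (↧ q ℤ.^ k) ℚ.* ι w         ∎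
      eqℤ = ι-injective {E ℤ.* ↥ q ℤ.^ k} {↧ q ℤ.^ k ℤ.* z} (cong K.rat eqK)

  -- Norms and discriminants.

  Nm : K → ℚ
  Nm (a +√ b) = a ℚ.* a ℚ.- δ ℚ.* (b ℚ.* b)

  Nm-* : ∀ α β → Nm (α *ᴷ β) ≡ Nm α ℚ.* Nm β
  Nm-* (a +√ b) (c +√ d) = lem δ a b c d
    where
    lem : ∀ δ a b c d → let p = a ℚ.* c ℚ.+ δ ℚ.* (b ℚ.* d) ; q = a ℚ.* d ℚ.+ b ℚ.* c in
      p ℚ.* p ℚ.- δ ℚ.* (q ℚ.* q) ≡ (a ℚ.* a ℚ.- δ ℚ.* (b ℚ.* b)) ℚ.* (c ℚ.* c ℚ.- δ ℚ.* (d ℚ.* d))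
    lem = solve-∀ ℚ-ring

  ι-minus : ∀ a b → ι (a ℤ.- b) ≡ ι a ℚ.- ι b
  ι-minus a b = trans (ι-+ a (ℤ.- b)) (cong (ι a ℚ.+_) (ι-neg b))

  Nm-+√ℤ : ∀ p q → Nm (p +√ℤ q) ≡ ι (norm D p q)
  Nm-+√ℤ p q = sym (trans (ι-minus (p ℤ.* p) _)
    (cong₂ ℚ._-_ (ι-* p p) (trans (ι-* (+ D) (q ℤ.* q)) (cong (δ ℚ.*_) (ι-* q q)))))

  half : ∀ {x} t → x ℚ.+ x ≡ ι (+ 2 ℤ.* t) → x ≡ ι t
  half {x} t eq = *-cancelˡ (ι (+ 2)) (λ ()) (trans (sym (double x)) (trans eq (ι-* (+ 2) t)))
    where
    double : ∀ x → x ℚ.+ x ≡ ι (+ 2) ℚ.* x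
    double x = trans (sym (cong₂ ℚ._+_ (ℚ.*-identityˡ x) (ℚ.*-identityˡ x)))
      (sym (ℚ.*-distribʳ-+ x 1ℚ 1ℚ))
  discriminant : ℚ → ℚ → ℚ
  discriminant t n = t ℚ.* t ℚ.- ((n ℚ.+ n) ℚ.+ (n ℚ.+ n))

  -- Trace and norm of a + b√D determine D (2b)², so it is an integer once they are.
  D[2b]² : ∀ a b → δ ℚ.* ((b ℚ.+ b) ℚ.* (b ℚ.+ b)) ≡ discriminant (a ℚ.+ a) (Nm (a +√ b))
  D[2b]² = lem δ
    where
    lem : ∀ δ a b → let N = a ℚ.* a ℚ.- δ ℚ.* (b ℚ.* b) in
      δ ℚ.* ((b ℚ.+ b) ℚ.* (b ℚ.+ b)) ≡ (a ℚ.+ a) ℚ.* (a ℚ.+ a) ℚ.- ((N ℚ.+ N) ℚ.+ (N ℚ.+ N))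
    lem = solve-∀ ℚ-ring

  ι-discriminant : ∀ t n → discriminant (ι t) (ι n) ≡ ι (t ℤ.* t ℤ.- + 4 ℤ.* n)
  ι-discriminant t n = begin
    ι t ℚ.* ι t ℚ.- ((ι n ℚ.+ ι n) ℚ.+ (ι n ℚ.+ ι n))  ≡⟨ cong₂ ℚ._-_ (ι-* t t) ι-4n ⟨
    ι (t ℤ.* t) ℚ.- ι (+ 4 ℤ.* n)                      ≡⟨ ι-minus (t ℤ.* t) (+ 4 ℤ.* n) ⟨
    ι (t ℤ.* t ℤ.- + 4 ℤ.* n)                          ∎
    where
    open ≡-Reasoning
    four : ∀ n → + 4 ℤ.* n ≡ (n ℤ.+ n) ℤ.+ (n ℤ.+ n)
    four = ℤ-Solver.solve-∀
    ι-4n : ι (+ 4 ℤ.* n) ≡ (ι n ℚ.+ ι n) ℚ.+ (ι n ℚ.+ ι n)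
    ι-4n = trans (cong ι (four n))
      (trans (ι-+ (n ℤ.+ n) (n ℤ.+ n)) (cong₂ ℚ._+_ (ι-+ n n) (ι-+ n n)))

  D[2b]²-integer : ∀ {a b} t n → a ℚ.+ a ≡ ι t → Nm (a +√ b) ≡ ι n →
    δ ℚ.* ((b ℚ.+ b) ℚ.* (b ℚ.+ b)) ≡ ι (t ℤ.* t ℤ.- + 4 ℤ.* n)
  D[2b]²-integer {a} {b} t n 2a≡t Nm≡n = begin
    δ ℚ.* ((b ℚ.+ b) ℚ.* (b ℚ.+ b))         ≡⟨ D[2b]² a b ⟩
    discriminant (a ℚ.+ a) (Nm (a +√ b))    ≡⟨ cong₂ discriminant 2a≡t Nm≡n ⟩
    discriminant (ι t) (ι n)                ≡⟨ ι-discriminant t n ⟩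
    ι (t ℤ.* t ℤ.- + 4 ℤ.* n)               ∎
    where open ≡-Reasoning
  D[2b]²-ι : ∀ {b} y → b ℚ.+ b ≡ ι y → δ ℚ.* ((b ℚ.+ b) ℚ.* (b ℚ.+ b)) ≡ ι (+ D ℤ.* (y ℤ.* y))
  D[2b]²-ι {b} y 2b≡y = begin
    δ ℚ.* ((b ℚ.+ b) ℚ.* (b ℚ.+ b))  ≡⟨ cong (λ z → δ ℚ.* (z ℚ.* z)) 2b≡y ⟩
    δ ℚ.* (ι y ℚ.* ι y)              ≡⟨ trans (ι-* (+ D) (y ℤ.* y)) (cong (δ ℚ.*_) (ι-* y y)) ⟨
    ι (+ D ℤ.* (y ℤ.* y))            ∎
    where open ≡-Reasoning

  halves⇒order : ∀ {a b} e t n y → + D ≡ + 2 ℤ.* (+ 1 ℤ.+ + 2 ℤ.* e) →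
    a ℚ.+ a ≡ ι t → b ℚ.+ b ≡ ι y → t ℤ.* t ℤ.- + 4 ℤ.* n ≡ + D ℤ.* (y ℤ.* y) → Order (a +√ b)
  halves⇒order {a} {b} e t n y D≡ 2a≡t 2b≡y eq = go (both-even {D} e t n y D≡ eq)
    where
    go : (∃[ t′ ] t ≡ + 2 ℤ.* t′) × (∃[ y′ ] y ≡ + 2 ℤ.* y′) → Order (a +√ b)
    go ((t′ , t≡2t′) , (y′ , y≡2y′)) = t′ , y′ ,
      cong₂ _+√_ (half t′ (trans 2a≡t (cong ι t≡2t′))) (half y′ (trans 2b≡y (cong ι y≡2y′)))

  -- Ideals and their generators.

  ⟨⟩-scale : ∀ α gs {x} → ⟨ gs ⟩ x → ⟨ map (α *ᴷ_) gs ⟩ (α *ᴷ x)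
  ⟨⟩-scale α []       refl = Kₛ.zeroʳ α
  ⟨⟩-scale α (g ∷ gs) (r , y , int , y∈ , refl) = r , α *ᴷ y , int , ⟨⟩-scale α gs y∈ , lem α r g y
    where
    open KSolver
    lem : ∀ α r g y → α *ᴷ (r *ᴷ g +ᴷ y) ≡ r *ᴷ (α *ᴷ g) +ᴷ α *ᴷ y
    lem = solve 4 (λ α r g y → α :* (r :* g :+ y) := r :* (α :* g) :+ α :* y) refl

  ⟨⟩-unscale : ∀ α gs {x} → ⟨ map (α *ᴷ_) gs ⟩ x → ∃[ y ] ⟨ gs ⟩ y × x ≡ α *ᴷ y
  ⟨⟩-unscale α []       refl = 0K , refl , sym (Kₛ.zeroʳ α)
  ⟨⟩-unscale α (g ∷ gs) (r , x , int , x∈ , refl) =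
    let y , y∈ , x≡αy = ⟨⟩-unscale α gs x∈ in
    r *ᴷ g +ᴷ y , (r , y , int , y∈ , refl) , trans (cong (r *ᴷ (α *ᴷ g) +ᴷ_) x≡αy) (lem α r g y)
    where
    open KSolver
    lem : ∀ α r g y → r *ᴷ (α *ᴷ g) +ᴷ α *ᴷ y ≡ α *ᴷ (r *ᴷ g +ᴷ y)
    lem = solve 4 (λ α r g y → r :* (α :* g) :+ α :* y := α :* (r :* g :+ y)) refl

  integral-ℤ : ∀ c → Integral (fromℤ c)
  integral-ℤ c = ℤ.- c ∷ [] , (begin
    fromℤ (ℤ.- c) +ᴷ fromℤ c *ᴷ 1K   ≡⟨ cong (fromℤ (ℤ.- c) +ᴷ_) (Kₛ.*-identityʳ (fromℤ c)) ⟩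
    fromℤ (ℤ.- c) +ᴷ fromℤ c         ≡⟨ cong (_+√ 0ℚ) (ι-+ (ℤ.- c) c) ⟨
    fromℤ (ℤ.- c ℤ.+ c)              ≡⟨ cong fromℤ (ℤ.+-inverseˡ c) ⟩
    0K                               ∎)
    where open ≡-Reasoning

  √D : K
  √D = 0ℚ +√ 1ℚ

  integral-√D : Integral √D
  integral-√D = ℤ.- + D ∷ 0ℤ ∷ [] ,
    cong₂ _+√_ (trans (cong (ℚ._+ (0ℚ ℚ.* x ℚ.+ δ ℚ.* (1ℚ ℚ.* y))) (ι-neg (+ D))) (rat-0 δ)) (irr-0 δ)
    where
    x y : ℚ
    x = 0ℚ ℚ.+ (0ℚ ℚ.* 1ℚ ℚ.+ δ ℚ.* (1ℚ ℚ.* 0ℚ))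
    y = 0ℚ ℚ.+ (0ℚ ℚ.* 0ℚ ℚ.+ 1ℚ ℚ.* 1ℚ)
    rat-0 : ∀ δ →
      let x = 0ℚ ℚ.+ (0ℚ ℚ.* 1ℚ ℚ.+ δ ℚ.* (1ℚ ℚ.* 0ℚ)) ; y = 0ℚ ℚ.+ (0ℚ ℚ.* 0ℚ ℚ.+ 1ℚ ℚ.* 1ℚ) in
      ℚ.- δ ℚ.+ (0ℚ ℚ.* x ℚ.+ δ ℚ.* (1ℚ ℚ.* y)) ≡ 0ℚ
    rat-0 = solve-∀ ℚ-ring
    irr-0 : ∀ δ →
      let x = 0ℚ ℚ.+ (0ℚ ℚ.* 1ℚ ℚ.+ δ ℚ.* (1ℚ ℚ.* 0ℚ)) ; y = 0ℚ ℚ.+ (0ℚ ℚ.* 0ℚ ℚ.+ 1ℚ ℚ.* 1ℚ) in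
      0ℚ ℚ.+ (0ℚ ℚ.* y ℚ.+ 1ℚ ℚ.* x) ≡ 0ℚ
    irr-0 = solve-∀ ℚ-ring

  unitIdeal ramifiedIdeal : NonzeroIdeal
  unitIdeal = record
    { generators = 1K ∷ [] ; integral = integral-ℤ 1ℤ ∷ [] ; nonzero = here λ () }
  ramifiedIdeal = record
    { generators = fromℤ (+ 2) ∷ √D ∷ []
    ; integral   = integral-ℤ (+ 2) ∷ integral-√D ∷ []
    ; nonzero    = here λ ()
    }

  -- If αI = β𝒪 and γI = εJ, then J = c𝒪 with c = βγ / (αε).
  principal : ∀ {I J} → I ∼ unitIdeal → I ∼ J →
    ∃[ α ] ∃[ ε ] ∃[ c ] Integral α × α ≢ 0K × Integral ε × ε ≢ 0K × ⟨ generators J ⟩ c ×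
      (∀ {g} → ⟨ generators J ⟩ g → ∃[ u ] Integral u × (α *ᴷ ε) *ᴷ g ≡ (α *ᴷ ε) *ᴷ (c *ᴷ u))
  principal {I} {J} (α , β , intα , α≢0 , _ , _ , αI⊆β , β⊆αI)
            (γ , ε , _ , _ , intε , ε≢0 , γI⊆εJ , εJ⊆γI) =
    -- i₁ stands for β / α and c for γ i₁ / ε; membership in the ideals provides both without a
    -- division.
    let i₁ , i₁∈I , β1≡αi₁ = ⟨⟩-unscale α (generators I) (β⊆αI (⟨⟩-scale β (1K ∷ []) 1∈))
        c , c∈J , γi₁≡εc = ⟨⟩-unscale ε (generators J) (γI⊆εJ (⟨⟩-scale γ (generators I) i₁∈I))
    in α , ε , c , intα , α≢0 , intε , ε≢0 , c∈J , λ {g} g∈J →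
      let i , i∈I , εg≡γi = ⟨⟩-unscale γ (generators I) (εJ⊆γI (⟨⟩-scale ε (generators J) g∈J))
          x , (u , z , int-u , z≡0 , x≡) , αi≡βx =
            ⟨⟩-unscale β (1K ∷ []) (αI⊆β (⟨⟩-scale α (generators I) i∈I))
      in u , int-u , (begin
        (α *ᴷ ε) *ᴷ g           ≡⟨ trans (Kₛ.*-assoc α ε g) (cong (α *ᴷ_) εg≡γi) ⟩
        α *ᴷ (γ *ᴷ i)           ≡⟨ rotate α γ i ⟩
        γ *ᴷ (α *ᴷ i)           ≡⟨ cong (γ *ᴷ_) αi≡βx ⟩
        γ *ᴷ (β *ᴷ x)           ≡⟨ cong (λ x → γ *ᴷ (β *ᴷ x)) (trans x≡ (cong (u *ᴷ 1K +ᴷ_) z≡0)) ⟩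
        γ *ᴷ (β *ᴷ (u *ᴷ 1K +ᴷ 0K)) ≡⟨ lem₁ γ β u ⟩
        (γ *ᴷ (β *ᴷ 1K)) *ᴷ u   ≡⟨ cong (λ x → (γ *ᴷ x) *ᴷ u) β1≡αi₁ ⟩
        (γ *ᴷ (α *ᴷ i₁)) *ᴷ u   ≡⟨ cong (_*ᴷ u) (rotate γ α i₁) ⟩
        (α *ᴷ (γ *ᴷ i₁)) *ᴷ u   ≡⟨ cong (λ x → (α *ᴷ x) *ᴷ u) γi₁≡εc ⟩
        (α *ᴷ (ε *ᴷ c)) *ᴷ u    ≡⟨ lem₂ α ε c u ⟩
        (α *ᴷ ε) *ᴷ (c *ᴷ u)    ∎)
    where
    open ≡-Reasoning
    open KSolver using (solve; _:*_; _:+_; _:=_; con)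
    1∈ : ⟨ 1K ∷ [] ⟩ 1K
    1∈ = 1K , 0K , integral-ℤ 1ℤ , refl , sym (trans (Kₛ.+-identityʳ _) (Kₛ.*-identityˡ 1K))
    rotate : ∀ a b c → a *ᴷ (b *ᴷ c) ≡ b *ᴷ (a *ᴷ c)
    rotate = solve 3 (λ a b c → a :* (b :* c) := b :* (a :* c)) refl
    lem₁ : ∀ γ β u → γ *ᴷ (β *ᴷ (u *ᴷ 1K +ᴷ 0K)) ≡ (γ *ᴷ (β *ᴷ 1K)) *ᴷ u
    lem₁ = solve 3 (λ γ β u → γ :* (β :* (u :* con 1 :+ con 0)) := (γ :* (β :* con 1)) :* u) refl
    lem₂ : ∀ α ε c u → (α *ᴷ (ε *ᴷ c)) *ᴷ u ≡ (α *ᴷ ε) *ᴷ (c *ᴷ u)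
    lem₂ = solve 4 (λ α ε c u → (α :* (ε :* c)) :* u := (α :* ε) :* (c :* u)) refl

  -- Taking norms turns a division by αε in `K` into the cancellation of nonzero rationals.
  Nm-cancel : ∀ {α ε g x} → Nm α ≢ 0ℚ → Nm ε ≢ 0ℚ → (α *ᴷ ε) *ᴷ g ≡ (α *ᴷ ε) *ᴷ x → Nm g ≡ Nm x
  Nm-cancel {α} {ε} {g} {x} Nα≢0 Nε≢0 eq =
    *-cancelˡ (Nm ε) Nε≢0 (*-cancelˡ (Nm α) Nα≢0
      (trans (sym (expand g)) (trans (cong Nm eq) (expand x))))
    where
    expand : ∀ y → Nm ((α *ᴷ ε) *ᴷ y) ≡ Nm α ℚ.* (Nm ε ℚ.* Nm y)
    expand y = trans (Nm-* (α *ᴷ ε) y)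
      (trans (cong (ℚ._* Nm y) (Nm-* α ε)) (ℚ.*-assoc (Nm α) (Nm ε) (Nm y)))

  norm-factor : ∀ p q {c u} → Order u → (P Q : ℤ) → c ≡ P +√ℤ Q → Nm (p +√ℤ q) ≡ Nm (c *ᴷ u) →
    ∃[ N ] norm D p q ≡ norm D P Q ℤ.* N
  norm-factor p q (u₁ , u₂ , refl) P Q refl eq =
    norm D u₁ u₂ , ι-injective {norm D p q} {norm D P Q ℤ.* norm D u₁ u₂} (begin
    ι (norm D p q)                             ≡⟨ Nm-+√ℤ p q ⟨
    Nm (p +√ℤ q)                               ≡⟨ eq ⟩
    Nm ((P +√ℤ Q) *ᴷ (u₁ +√ℤ u₂))              ≡⟨ Nm-* (P +√ℤ Q) (u₁ +√ℤ u₂) ⟩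
    Nm (P +√ℤ Q) ℚ.* Nm (u₁ +√ℤ u₂)            ≡⟨ cong₂ ℚ._*_ (Nm-+√ℤ P Q) (Nm-+√ℤ u₁ u₂) ⟩
    ι (norm D P Q) ℚ.* ι (norm D u₁ u₂)        ≡⟨ ι-* (norm D P Q) (norm D u₁ u₂) ⟨
    ι (norm D P Q ℤ.* norm D u₁ u₂)            ∎)
    where open ≡-Reasoning

  -- The rational part is a combination of 2 and D; this is the form from which `∣norm∣≡2` obtains
  -- an even norm.
  ramified-member : ∀ r₁ r₂ s₁ s₂ →
    (r₁ +√ℤ r₂) *ᴷ fromℤ (+ 2) +ᴷ ((s₁ +√ℤ s₂) *ᴷ √D +ᴷ 0K) ≡
    + 2 ℤ.* r₁ ℤ.+ + D ℤ.* s₂ +√ℤ + 2 ℤ.* r₂ ℤ.+ s₁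
  ramified-member r₁ r₂ s₁ s₂ = begin
    (r₁ +√ℤ r₂) *ᴷ (+ 2 +√ℤ 0ℤ) +ᴷ ((s₁ +√ℤ s₂) *ᴷ (0ℤ +√ℤ 1ℤ) +ᴷ 0K)
      ≡⟨ cong₂ _+ᴷ_ (+√ℤ-* r₁ r₂ (+ 2) 0ℤ)
           (trans (Kₛ.+-identityʳ ((s₁ +√ℤ s₂) *ᴷ √D)) (+√ℤ-* s₁ s₂ 0ℤ 1ℤ)) ⟩
    (a +√ℤ b) +ᴷ (c +√ℤ d)
      ≡⟨ +√ℤ-+ a b c d ⟩
    a ℤ.+ c +√ℤ b ℤ.+ d
      ≡⟨ cong₂ _+√ℤ_ (lem₁ (+ D) r₁ r₂ s₁ s₂) (lem₂ r₁ r₂ s₁ s₂) ⟩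
    + 2 ℤ.* r₁ ℤ.+ + D ℤ.* s₂ +√ℤ + 2 ℤ.* r₂ ℤ.+ s₁ ∎
    where
    open ≡-Reasoning
    a b c d : ℤ
    a = r₁ ℤ.* + 2 ℤ.+ + D ℤ.* (r₂ ℤ.* 0ℤ)
    b = r₁ ℤ.* 0ℤ ℤ.+ r₂ ℤ.* + 2
    c = s₁ ℤ.* 0ℤ ℤ.+ + D ℤ.* (s₂ ℤ.* 1ℤ)
    d = s₁ ℤ.* 1ℤ ℤ.+ s₂ ℤ.* 0ℤ
    lem₁ : ∀ D r₁ r₂ s₁ s₂ →
      (r₁ ℤ.* + 2 ℤ.+ D ℤ.* (r₂ ℤ.* 0ℤ)) ℤ.+ (s₁ ℤ.* 0ℤ ℤ.+ D ℤ.* (s₂ ℤ.* 1ℤ)) ≡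
      + 2 ℤ.* r₁ ℤ.+ D ℤ.* s₂
    lem₁ = ℤ-Solver.solve-∀
    lem₂ : ∀ r₁ r₂ s₁ s₂ →
      (r₁ ℤ.* 0ℤ ℤ.+ r₂ ℤ.* + 2) ℤ.+ (s₁ ℤ.* 1ℤ ℤ.+ s₂ ℤ.* 0ℤ) ≡ + 2 ℤ.* r₂ ℤ.+ s₁
    lem₂ = ℤ-Solver.solve-∀

  -- Integers of K and the ramified ideal for squarefree D ≡ 2 (mod 4).

  module _ (squarefree : Squarefree D) (e : ℤ) (D≡ : + D ≡ + 2 ℤ.* (+ 1 ℤ.+ + 2 ℤ.* e)) where

    -- D (2b)² = t² - 4n is an integer, so 2b is one because D is squarefree. This leaves a and b at
    -- worst half-integers, and D ≡ 2 (mod 4) excludes proper halves.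
    trace-norm⇒order : ∀ {a b} → IsInteger (a ℚ.+ a) → IsInteger (Nm (a +√ b)) → Order (a +√ b)
    trace-norm⇒order {a} {b} (t , 2a≡t) (n , Nm≡n) =
      go (squarefree*square⇒integer squarefree (b ℚ.+ b) (t ℤ.* t ℤ.- + 4 ℤ.* n , D≡M))
      where
      D≡M : δ ℚ.* ((b ℚ.+ b) ℚ.* (b ℚ.+ b)) ≡ ι (t ℤ.* t ℤ.- + 4 ℤ.* n)
      D≡M = D[2b]²-integer {a} {b} t n 2a≡t Nm≡n
      go : IsInteger (b ℚ.+ b) → Order (a +√ b)
      go (y , 2b≡y) = halves⇒order e t n y D≡ 2a≡t 2b≡y 
        (ι-injective {t ℤ.* t ℤ.- + 4 ℤ.* n} {+ D ℤ.* (y ℤ.* y)}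
          (trans (sym D≡M) (D[2b]²-ι {b} y 2b≡y)))
    -- The trace α + `conj α` and the norm α · `conj α` are almost integral along with α, and they
    -- are rational, hence integers.
    integral⇒order : ∀ {α} → Integral α → Order α
    integral⇒order {a +√ b} int = trace-norm⇒order
      (almostIntegral-ℚ⇒integer (subst AlmostIntegral
        (cong (a ℚ.+ a +√_) (ℚ.+-inverseʳ b))
        (almostIntegral-+ {α} {conj α} ai (almostIntegral-conj ai))))
      (almostIntegral-ℚ⇒integer (subst AlmostIntegral
        (cong₂ _+√_ (lem₁ δ a b) (lem₂ a b))
        (almostIntegral-* {α} {conj α} ai (almostIntegral-conj ai))))
      where
      α : K
      α = a +√ b
      ai : AlmostIntegral α
      ai = integral⇒almostIntegral int
      lem₁ : ∀ δ a b → a ℚ.* a ℚ.+ δ ℚ.* (b ℚ.* ℚ.- b) ≡ a ℚ.* a ℚ.- δ ℚ.* (b ℚ.* b)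
      lem₁ = solve-∀ ℚ-ring
      lem₂ : ∀ a b → a ℚ.* ℚ.- b ℚ.+ b ℚ.* a ≡ 0ℚ
      lem₂ = solve-∀ ℚ-ring
    -- Here c is the generator of (2, √D), with cofactors u and v; the relations 2 = c u and √D = c
    -- v enter through their norms.
    principal-generator⇒∣norm∣≡2 : ∀ {c r s u v} → Order r → Order s → Order u → Order v →
      c ≡ r *ᴷ fromℤ (+ 2) +ᴷ (s *ᴷ √D +ᴷ 0K) →
      Nm (fromℤ (+ 2)) ≡ Nm (c *ᴷ u) → Nm √D ≡ Nm (c *ᴷ v) →
      ∃[ p ] ∃[ q ] ∣ norm D p q ∣ ≡ 2
    principal-generator⇒∣norm∣≡2 {c} {r} {s} {u} {v}
      (r₁ , r₂ , r≡) (s₁ , s₂ , s≡) ord-u ord-v c≡ N2≡ N√D≡ =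
      P , Q , ∣norm∣≡2 {D} e r₁ s₂ Q (proj₁ 2-factor) (proj₁ √D-factor) D≡
        (trans (four (+ D)) (proj₂ 2-factor)) (trans (minus (+ D)) (proj₂ √D-factor))
      where
      P Q : ℤ
      P = + 2 ℤ.* r₁ ℤ.+ + D ℤ.* s₂
      Q = + 2 ℤ.* r₂ ℤ.+ s₁
      c≡P+Q√D : c ≡ P +√ℤ Q
      c≡P+Q√D = trans c≡
        (trans (cong₂ (λ r s → r *ᴷ fromℤ (+ 2) +ᴷ (s *ᴷ √D +ᴷ 0K)) r≡ s≡)
               (ramified-member r₁ r₂ s₁ s₂))
      2-factor : ∃[ N ] norm D (+ 2) 0ℤ ≡ norm D P Q ℤ.* N
      2-factor = norm-factor (+ 2) 0ℤ {c} {u} ord-u P Q c≡P+Q√D N2≡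
      √D-factor : ∃[ N ] norm D 0ℤ 1ℤ ≡ norm D P Q ℤ.* N
      √D-factor = norm-factor 0ℤ 1ℤ {c} {v} ord-v P Q c≡P+Q√D N√D≡
      four : ∀ D → + 4 ≡ + 2 ℤ.* + 2 ℤ.- D ℤ.* (0ℤ ℤ.* 0ℤ)
      four = ℤ-Solver.solve-∀
      minus : ∀ D → ℤ.- D ≡ 0ℤ ℤ.* 0ℤ ℤ.- D ℤ.* (1ℤ ℤ.* 1ℤ)
      minus = ℤ-Solver.solve-∀
    2∈ramified : ⟨ fromℤ (+ 2) ∷ √D ∷ [] ⟩ (fromℤ (+ 2))
    2∈ramified = 1K , 0K , integral-ℤ 1ℤ ,
      (0K , 0K , integral-ℤ 0ℤ , refl , sym (trans (Kₛ.+-identityʳ (0K *ᴷ √D)) (Kₛ.zeroˡ √D))) ,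
      sym (trans (Kₛ.+-identityʳ (1K *ᴷ fromℤ (+ 2))) (Kₛ.*-identityˡ (fromℤ (+ 2))))

    √D∈ramified : ⟨ fromℤ (+ 2) ∷ √D ∷ [] ⟩ √D
    √D∈ramified = 0K , √D , integral-ℤ 0ℤ ,
      (1K , 0K , integral-ℤ 1ℤ , refl , sym (trans (Kₛ.+-identityʳ (1K *ᴷ √D)) (Kₛ.*-identityˡ √D))) ,
      sym (trans (cong (_+ᴷ √D) (Kₛ.zeroˡ (fromℤ (+ 2)))) (Kₛ.+-identityˡ √D))
    -- The assumption on norms lets the multipliers α and ε be cancelled. It is a hypothesis at this
    -- point because its source is the shape n² + 1 of D, through the descent.
    ramified-principal⇒∣norm∣≡2 : (∀ {α} → Order α → α ≢ 0K → Nm α ≢ 0ℚ) →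
      ∀ {I} → I ∼ unitIdeal → I ∼ ramifiedIdeal → ∃[ p ] ∃[ q ] ∣ norm D p q ∣ ≡ 2
    ramified-principal⇒∣norm∣≡2 anisotropic {I} I∼1 I∼R = go (principal {I} {ramifiedIdeal} I∼1 I∼R)
      where
      go : ∃[ α ] ∃[ ε ] ∃[ c ] Integral α × α ≢ 0K × Integral ε × ε ≢ 0K ×
        ⟨ fromℤ (+ 2) ∷ √D ∷ [] ⟩ c ×
        (∀ {g} → ⟨ fromℤ (+ 2) ∷ √D ∷ [] ⟩ g →
          ∃[ u ] Integral u × (α *ᴷ ε) *ᴷ g ≡ (α *ᴷ ε) *ᴷ (c *ᴷ u)) →
        ∃[ p ] ∃[ q ] ∣ norm D p q ∣ ≡ 2
      go (α , ε , c , int-α , α≢0 , int-ε , ε≢0 ,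
          (r , y , int-r , (s , z , int-s , z≡0 , y≡) , c≡) , divide) =
        conclude (divide 2∈ramified) (divide √D∈ramified)
        where
        cancel : ∀ g x → (α *ᴷ ε) *ᴷ g ≡ (α *ᴷ ε) *ᴷ x → Nm g ≡ Nm x
        cancel g x = Nm-cancel {α} {ε} {g} {x}
          (anisotropic {α} (integral⇒order int-α) α≢0)
          (anisotropic {ε} (integral⇒order int-ε) ε≢0)
        conclude :
          (∃[ u ] Integral u × (α *ᴷ ε) *ᴷ fromℤ (+ 2) ≡ (α *ᴷ ε) *ᴷ (c *ᴷ u)) →
          (∃[ v ] Integral v × (α *ᴷ ε) *ᴷ √D ≡ (α *ᴷ ε) *ᴷ (c *ᴷ v)) →
          ∃[ p ] ∃[ q ] ∣ norm D p q ∣ ≡ 2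
        conclude (u , int-u , A2≡) (v , int-v , A√D≡) =
          principal-generator⇒∣norm∣≡2 {c} {r} {s} {u} {v}
            (integral⇒order int-r) (integral⇒order int-s)
            (integral⇒order int-u) (integral⇒order int-v)
            (trans c≡ (cong (r *ᴷ fromℤ (+ 2) +ᴷ_) (trans y≡ (cong (s *ᴷ √D +ᴷ_) z≡0))))
            (cancel (fromℤ (+ 2)) (c *ᴷ u) A2≡) (cancel √D (c *ᴷ v) A√D≡)

-- Class number one excludes n ≥ 3.

2≢square : ∀ r → 2 ≢ r * r
2≢square (suc (suc r)) = ℕ.<⇒≢ (ℕ.≤-trans (s≤s (s≤s (s≤s z≤n))) (ℕ.*-mono-≤ 2≤2+r 2≤2+r))
  where
  2≤2+r : 2 ℕ.≤ suc (suc r)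
  2≤2+r = s≤s (s≤s z≤n)

module _ {D} (k : ℕ) (1≤k : 1 ℕ.≤ k) (D≡1+n² : D ≡ suc (suc k * suc k)) where
  open QuadraticField D using (0K)
  open Arithmetic D

  descent : ∀ p q → ∣ norm D p q ∣ ℕ.≤ 2 →
    ∃[ r ] ∣ norm D p q ∣ ≡ r * r × (r ≡ 0 → p ≡ 0ℤ × q ≡ 0ℤ)
  descent = subst
    (λ d → ∀ p q → ∣ norm d p q ∣ ℕ.≤ 2 →
      ∃[ r ] ∣ norm d p q ∣ ≡ r * r × (r ≡ 0 → p ≡ 0ℤ × q ≡ 0ℤ))
    (sym D≡1+n²) (Descent.norm-descent k 1≤k)

  ∣norm∣≢2 : ∀ p q → ∣ norm D p q ∣ ≢ 2
  ∣norm∣≢2 p q eq =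
    let r , N≡rr , _ = descent p q (ℕ.≤-reflexive eq) in 2≢square r (trans (sym eq) N≡rr)

  -- Norm 0 is within reach of the descent, which then yields r = 0 and p = q = 0; this takes the
  -- place of the irrationality of √D.
  anisotropic : ∀ {α} → Order α → α ≢ 0K → Nm α ≢ 0ℚ
  anisotropic (p , q , refl) α≢0 N≡0 =
    let N≡0ℤ = ι-injective {norm D p q} {0ℤ} (trans (sym (Nm-+√ℤ p q)) N≡0)
        r , N≡rr , r≡0⇒ = descent p q (subst (λ z → ∣ z ∣ ℕ.≤ 2) (sym N≡0ℤ) z≤n)
        rr≡0 : r * r ≡ 0
        rr≡0 = trans (sym N≡rr) (cong ∣_∣ N≡0ℤ)
        p≡0 , q≡0 = r≡0⇒ ([ id , id ]′ (ℕ.m*n≡0⇒m≡0∨n≡0 r rr≡0))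
    in α≢0 (cong₂ (λ p q → ι p QuadraticField.+√ ι q) p≡0 q≡0)

  classNumber≢1 : Squarefree D → ∀ e → + D ≡ + 2 ℤ.* (+ 1 ℤ.+ + 2 ℤ.* e) → ¬ (ClassNumber[ D ]≡ 1)
  -- `Fin 1` has a single index, so `I zero` represents the classes of both ideals.
  classNumber≢1 sf e D≡ (I , _ , surjective) with surjective unitIdeal | surjective ramifiedIdeal
  ... | zero , I∼1 | zero , I∼R =
    let p , q , eq = ramified-principal⇒∣norm∣≡2 sf e D≡ anisotropic {I zero} (I∼1 refl) (I∼R refl)
    in ∣norm∣≢2 p q eq

odd : ∀ n → ¬ (2 ∣ n) → ∃[ m ] n ≡ suc (2 * m)
odd zero          2∤n = contradiction (divides 0 refl) 2∤n
odd (suc zero)    2∤n = 0 , refl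
odd (suc (suc n)) 2∤n =
  let m , n≡ = odd n (λ { (divides q n≡2q) → 2∤n (divides (suc q) (cong (λ x → suc (suc x)) n≡2q)) })
  in suc m , cong (λ x → suc (suc x)) (trans n≡ (sym (ℕ.+-suc m (m + 0))))

theorem1p5 : (n : ℕ) → 0 < n → ¬ (2 ∣ n) →
    Squarefree (n ^ 2 + 1) →
    ClassNumber[ n ^ 2 + 1 ]≡ 1 →
    Any (λ p → (n ^ 2 + 1) IsSquareModulo p) (5 ∷ 7 ∷ 41 ∷ 61 ∷ 1861 ∷ [])
theorem1p5 n _ 2∤n squarefree h≡1 with odd n 2∤n
... | zero  , refl = there (here (+ 3 , divides 1 refl))
... | suc m , n≡ = contradiction h≡1
  (classNumber≢1 (2 * suc m) (s≤s z≤n) D≡1+[1+k]² squarefree (+ f) +D≡)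
  where
  -- With n = 2j + 1 and j = `suc m`, D = 4j² + 4j + 2 = 2 (1 + 2 (j² + j)), so j² + j serves as e.
  f : ℕ
  f = suc m * suc m + suc m
  D≡1+n² : n ^ 2 + 1 ≡ suc (n * n)
  D≡1+n² = trans (ℕ.+-comm (n ^ 2) 1) (cong (λ x → suc (n * x)) (ℕ.*-identityʳ n))
  D≡1+[1+k]² : n ^ 2 + 1 ≡ suc (suc (2 * suc m) * suc (2 * suc m))
  D≡1+[1+k]² = trans D≡1+n² (cong (λ n → suc (n * n)) n≡)
  twice-odd : ∀ m → suc (suc (2 * m) * suc (2 * m)) ≡ 2 * (1 + 2 * (m * m + m))
  twice-odd = ℕ-Solver.solve-∀
  +D≡ : + (n ^ 2 + 1) ≡ + 2 ℤ.* (+ 1 ℤ.+ + 2 ℤ.* + f)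
  +D≡ = trans (cong +_ (trans D≡1+[1+k]² (twice-odd (suc m))))
    (trans (ℤ.pos-* 2 (1 + 2 * f)) (cong (λ x → + 2 ℤ.* (+ 1 ℤ.+ x)) (ℤ.pos-* 2 f)))
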